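{- There exist functions $f, g \colon \mathbb{N}\times\mathbb{N} \to \mathbb{N}$ with $f(k,r) = O(k^2 r^3\,\mathrm{polylog}(kr))$ and $g(k,r) = O(k^4 r^2\,\mathrm{polylog}(kr))$ such that for every integer $r \ge 2$, every graph $G$ and every positive integer $k$: either $G$ contains $k$ mutually edge-disjoint models of $\theta_r$, or there is a set $X \subseteq E(G)$ with $|X| \le f(k,r)$ meeting the edge set of every model of $\theta_r$ in $G$; and likewise with $g(k,r)$ in place of $f(k,r)$.
   Context: Graphs are finite and may have multiple edges. For $r \ge 1$, $\theta_r$ is the multigraph with two vertices and $r$ parallel edges between them. Contracting an edge $\{u,v\}$ removes it and identifies $u$ and $v$, keeping all resulting multiple edges. A subgraph $H$ of $G$ is a model of $\theta_r$ in $G$ if $H$ can be transformed into $\theta_r$ by a sequence of edge contractions. $\mathrm{polylog}(x)$ denotes $(\log x)^{O(1)}$, and the implicit constants in the $O(\cdot)$ bounds do not depend on $k$ or $r$. -}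

module Defs where

open import Data.Nat using (ℕ; zero; suc; _+_; _*_; _^_; _≤_)
open import Data.Fin using (Fin; zero; suc; punchIn; punchOut; _≟_)
open import Data.Fin.Subset using (Subset; _∈_; ∣_∣)
open import Data.Product using (Σ; ∃; _×_; _,_; proj₁; proj₂)
open import Data.Sum using (_⊎_)
open import Function.Bundles using (_↔_; Inverse)
open import Function.Definitions using (Injective)
open import Relation.Binary.PropositionalEquality using (_≡_; _≢_; refl)
open import Relation.Nullary using (¬_; yes; no)

-- A finite multigraph with vertex set Fin n and edge set Fin m;
-- each edge has an (ordered, but only used as unordered) pair of endpoints.
-- Loops are representable (they may arise during contraction).
Graph : ℕ → ℕ → Set
Graph n m = Fin m → Fin n × Fin n

Loopless : ∀ {n m} → Graph n m → Set
Loopless {m = m} G = (e : Fin m) → proj₁ (G e) ≢ proj₂ (G e)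

θ : (r : ℕ) → Graph 2 r
θ r e = (zero , suc zero)

SamePair : ∀ {n} → Fin n × Fin n → Fin n × Fin n → Set
SamePair (a , b) (c , d) = ((a ≡ c) × (b ≡ d)) ⊎ ((a ≡ d) × (b ≡ c))

record Iso {n m n' m'} (G : Graph n m) (H : Graph n' m') : Set where
  field
    vmap : Fin n ↔ Fin n'
    emap : Fin m ↔ Fin m'
    preserves : (e : Fin m) →
      SamePair (H (Inverse.to emap e))
               (Inverse.to vmap (proj₁ (G e)) , Inverse.to vmap (proj₂ (G e)))

merge : ∀ {n} (u v : Fin (suc n)) → u ≢ v → Fin (suc n) → Fin n
merge u v u≢v w with w ≟ v
... | yes _ = punchOut {i = v} {j = u} (λ eq → u≢v (Relation.Binary.PropositionalEquality.sym eq))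
... | no w≢v = punchOut {i = v} {j = w} (λ eq → w≢v (Relation.Binary.PropositionalEquality.sym eq))

contract : ∀ {n m} (G : Graph (suc n) (suc m)) (e : Fin (suc m)) →
           proj₁ (G e) ≢ proj₂ (G e) → Graph n m
contract G e ne e' =
  merge (proj₁ (G e)) (proj₂ (G e)) ne (proj₁ (G (punchIn e e'))) ,
  merge (proj₁ (G e)) (proj₂ (G e)) ne (proj₂ (G (punchIn e e')))

data ContractsTo (r : ℕ) : ∀ {n m} → Graph n m → Set where
  done : ∀ {n m} {G : Graph n m} → Iso G (θ r) → ContractsTo r G
  step : ∀ {n m} {G : Graph (suc n) (suc m)} (e : Fin (suc m))
           (ne : proj₁ (G e) ≢ proj₂ (G e)) →
           ContractsTo r (contract G e ne) → ContractsTo r G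

record Model {n m} (G : Graph n m) (r : ℕ) : Set where
  field
    hn hm   : ℕ
    H       : Graph hn hm
    vemb    : Fin hn → Fin n
    eemb    : Fin hm → Fin m
    vinj    : Injective _≡_ _≡_ vemb
    einj    : Injective _≡_ _≡_ eemb
    compat  : (e : Fin hm) → G (eemb e) ≡ (vemb (proj₁ (H e)) , vemb (proj₂ (H e)))
    contracts : ContractsTo r H

_∈E_ : ∀ {n m} {G : Graph n m} {r} → Fin m → Model G r → Set
e ∈E M = ∃ λ e' → Model.eemb M e' ≡ e

DisjointModels : ∀ {n m} (G : Graph n m) (r k : ℕ) → Set
DisjointModels {m = m} G r k =
  Σ (Fin k → Model G r) λ M →
    (i j : Fin k) → i ≢ j → (e : Fin m) → ¬ ((e ∈E M i) × (e ∈E M j))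

Hits : ∀ {n m} (G : Graph n m) (r : ℕ) → Subset m → Set
Hits {m = m} G r X = (M : Model G r) → ∃ λ (e : Fin m) → (e ∈E M) × (e ∈ X)

EPAlternative : (b : ℕ → ℕ → ℕ) → Set
EPAlternative b = (r : ℕ) → 2 ≤ r → ∀ {n m} (G : Graph n m) → Loopless G →
  (k : ℕ) → 1 ≤ k →
  DisjointModels G r k ⊎ (Σ (Subset m) λ X → (∣ X ∣ ≤ b k r) × Hits G r X)

{-# OPTIONS --safe #-}

-- A connected graph contains θᵣ as a contraction of a subgraph iff it has a subgraph with a bond of size at least r.
-- Both bounds follow from one bound O(k² r² log(kr)), obtained in two steps.
--
-- (1) A bond of size b ≥ C k r² log(kr) yields k edge-disjoint models. Take spanning trees of its two sides and merge
-- leaves into their parents until each remaining "hub" carries about 8r ends of bond edges. The quotient has average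
-- degree of order r, so growing balls finds a subgraph of logarithmic radius with at least r edges per vertex, and a
-- fundamental cut of its tree gives a model with O(r log) edges. Deleting it, together with all bond edges whose tree
-- paths to a hub meet its paths, costs O(r² log) bond edges, so this can be repeated k times.
--
-- (2) If a graph has a model, then descending through cut vertices gives a connected set D without a model, and
-- a vertex t outside D, such that D + t has a model and the boundary of D is a bond. Either the bond is large
-- and (1) applies, or its at most b edges are put in the cover and D is removed, which uses up one model of the packing.

module Submission where

open import Defs
open import Data.Bool using (Bool; true; false; not; _∧_; _∨_; if_then_else_)
open import Data.Empty using (⊥; ⊥-elim)
open import Data.Fin using (Fin; zero; suc; punchIn; punchOut; inject≤; _≟_)
open import Data.Fin.Properties using (suc-injective; any?; injective⇒≤; inject≤-injective; punchIn-punchOut; punchOut-punchIn; punchOut-cong; punchInᵢ≢i)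
open import Data.Fin.Subset using (Subset; ∣_∣)
open import Data.Fin.Subset.Properties using (anySubset?)
open import Data.Nat using (ℕ; zero; suc; _+_; _*_; _^_; _≤_; _<_; z≤n; s≤s; >-nonZero)
open import Data.Nat.Logarithm using (⌊log₂_⌋; ⌊log₂⌋-mono-≤; ⌊log₂[2^n]⌋≡n)
open import Data.Nat.Properties hiding (_≟_; suc-injective)
open import Data.Nat.Tactic.RingSolver using (solve-∀)
open import Algebra.Properties.CommutativeSemigroup +-commutativeSemigroup using (interchange; x∙yz≈y∙xz)
open import Data.Product using (Σ; ∃; _×_; _,_; proj₁; proj₂)
open import Data.Sum using (_⊎_; inj₁; inj₂)
open import Data.Vec using (lookup; tabulate)
open import Data.Vec.Properties using (lookup∘tabulate; lookup⇒[]=)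
open import Function using (_∘_; case_of_; id)
open import Function.Bundles using (Inverse)
open import Function.Properties.Inverse using (↔-refl)
open import Relation.Binary.PropositionalEquality using (_≡_; _≢_; refl; sym; trans; cong; cong₂; subst; subst₂)
open import Relation.Nullary using (¬_; Dec; yes; no; does)

-- Boolean sets and their cardinalities

-- Models and contraction sequences occur only at the two ends of the argument. In between,
-- everything is a `Theta` on an edge set `P` of one fixed graph: this notion is monotone in `P`,
-- decidable, and pulled back along a clustering, and a bond is itself a `Theta` with many tokens.
-- The obstacle in step (1) is that models which are edge-disjoint in the quotient may still run
-- through the same tree edges of `G`. A leaf is therefore merged upwards only if at most 8r bond
-- edges end at it, so a tree path can share edges with the paths of few bond edges; paths that
-- merely end at a common hub do not conflict. The threshold 8r serves two ends. It is the price
-- paid for each path used, and it leaves at most b/(4r) hubs, so that a density of 2r edges per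
-- vertex uses up only about half of the b bond edges and the other half pays for k rounds of
-- deletion. The radius L of the balls enters the required b linearly, whereas the balls need b <
-- 2^L; a multiple of log(kr) satisfies both.

∧-intro : ∀ {a b} → a ≡ true → b ≡ true → a ∧ b ≡ true
∧-intro refl refl = refl

∧-elim : ∀ a {b} → a ∧ b ≡ true → a ≡ true × b ≡ true
∧-elim true p = refl , p

∨-introˡ : ∀ {a b} → a ≡ true → a ∨ b ≡ true
∨-introˡ refl = refl

∨-introʳ : ∀ a {b} → b ≡ true → a ∨ b ≡ true
∨-introʳ true  p = refl
∨-introʳ false p = p

∨-elim : ∀ a {b} → a ∨ b ≡ true → a ≡ true ⊎ b ≡ true
∨-elim true  p = inj₁ refl
∨-elim false p = inj₂ p

∨-false : ∀ a {b} → a ∨ b ≡ false → a ≡ false × b ≡ false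
∨-false false p = refl , p

not-intro : ∀ {a} → a ≡ false → not a ≡ true
not-intro refl = refl

not-elim : ∀ {a} → not a ≡ true → a ≡ false
not-elim {false} _ = refl

tf-absurd : ∀ {A : Set} {a} → a ≡ true → a ≡ false → A
tf-absurd refl ()

bool : ∀ a → a ≡ true ⊎ a ≡ false
bool true  = inj₁ refl
bool false = inj₂ refl

¬true⇒false : ∀ {a} → ¬ (a ≡ true) → a ≡ false
¬true⇒false {true}  f = ⊥-elim (f refl)
¬true⇒false {false} f = refl

_==_ : ∀ {n} → Fin n → Fin n → Bool
x == y = does (x ≟ y)

==⇒≡ : ∀ {n} (x y : Fin n) → (x == y) ≡ true → x ≡ y
==⇒≡ x y p with x ≟ y
... | yes q = q

≡⇒== : ∀ {n} {x y : Fin n} → x ≡ y → (x == y) ≡ true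
≡⇒== {x = x} {y} q with x ≟ y
... | yes _ = refl
... | no ¬q = ⊥-elim (¬q q)

≢⇒== : ∀ {n} {x y : Fin n} → x ≢ y → (x == y) ≡ false
≢⇒== {x = x} {y} ¬q with x ≟ y
... | yes q = ⊥-elim (¬q q)
... | no _ = refl

eqb : Bool → Bool → Bool
eqb true  b = b
eqb false b = not b

eqb⇒≡ : ∀ {a b} → eqb a b ≡ true → a ≡ b
eqb⇒≡ {true} {true} _ = refl
eqb⇒≡ {false} {false} _ = refl

≡⇒eqb : ∀ {a b} → a ≡ b → eqb a b ≡ true
≡⇒eqb {true} refl = refl
≡⇒eqb {false} refl = refl

≢⇒eqb : ∀ {a b} → a ≢ b → eqb a b ≡ false
≢⇒eqb {a} {b} ne = ¬true⇒false (ne ∘ eqb⇒≡)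

any : ∀ {n} → (Fin n → Bool) → Bool
any {zero}  f = false
any {suc n} f = f zero ∨ any (f ∘ suc)

any-intro : ∀ {n} (f : Fin n → Bool) x → f x ≡ true → any f ≡ true
any-intro f zero    p = ∨-introˡ p
any-intro f (suc x) p = ∨-introʳ (f zero) (any-intro (f ∘ suc) x p)

any-elim : ∀ {n} (f : Fin n → Bool) → any f ≡ true → ∃ λ x → f x ≡ true
any-elim {suc n} f p with ∨-elim (f zero) p
... | inj₁ q = zero , q
... | inj₂ q with any-elim (f ∘ suc) q
...   | x , r = suc x , r

any-false : ∀ {n} (f : Fin n → Bool) → any f ≡ false → ∀ x → f x ≡ false
any-false f p x = ¬true⇒false (λ q → tf-absurd (any-intro f x q) p)

insert : ∀ {n} → Fin n → (Fin n → Bool) → Fin n → Bool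
insert v S x = S x ∨ (v == x)

insert-old : ∀ {n} (v : Fin n) (S : Fin n → Bool) {x} → S x ≡ true → insert v S x ≡ true
insert-old v S = ∨-introˡ

insert-new : ∀ {n} (v : Fin n) (S : Fin n → Bool) → insert v S v ≡ true
insert-new v S = ∨-introʳ (S v) (≡⇒== {x = v} refl)

insert-elim : ∀ {n} (v : Fin n) (S : Fin n → Bool) {x} → insert v S x ≡ true → S x ≡ true ⊎ v ≡ x
insert-elim v S {x} p with ∨-elim (S x) p
... | inj₁ q = inj₁ q
... | inj₂ q = inj₂ (==⇒≡ v x q)

b2n : Bool → ℕ
b2n true  = 1
b2n false = 0

count : ∀ {n} → (Fin n → Bool) → ℕ
count {zero}  f = 0
count {suc n} f = b2n (f zero) + count (f ∘ suc)

count-cong : ∀ {n} {f g : Fin n → Bool} → (∀ x → f x ≡ g x) → count f ≡ count g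
count-cong {zero}  h = refl
count-cong {suc n} h = cong₂ _+_ (cong b2n (h zero)) (count-cong (h ∘ suc))

b2n-mono : ∀ {a b} → (a ≡ true → b ≡ true) → b2n a ≤ b2n b
b2n-mono {false} h = z≤n
b2n-mono {true}  h = ≤-reflexive (cong b2n (sym (h refl)))

count-mono : ∀ {n} {f g : Fin n → Bool} → (∀ x → f x ≡ true → g x ≡ true) → count f ≤ count g
count-mono {zero}  h = z≤n
count-mono {suc n} h = +-mono-≤ (b2n-mono (h zero)) (count-mono (h ∘ suc))

count-∨ : ∀ {n} (f g : Fin n → Bool) → count (λ x → f x ∨ g x) ≤ count f + count g
count-∨ {zero}  f g = z≤n
count-∨ {suc n} f g =
  ≤-trans (+-mono-≤ (b2n-∨ (f zero) (g zero)) (count-∨ (f ∘ suc) (g ∘ suc)))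
    (≤-reflexive (interchange (b2n (f zero)) (b2n (g zero)) _ _))
  where
  b2n-∨ : ∀ a b → b2n (a ∨ b) ≤ b2n a + b2n b
  b2n-∨ true  b = s≤s z≤n
  b2n-∨ false b = ≤-refl

count-split : ∀ {n} (f g : Fin n → Bool) →
  count f ≡ count (λ x → f x ∧ g x) + count (λ x → f x ∧ not (g x))
count-split {zero}  f g = refl
count-split {suc n} f g =
  trans (cong₂ _+_ (b2n-split (f zero) (g zero)) (count-split (f ∘ suc) (g ∘ suc)))
    (interchange (b2n (f zero ∧ g zero)) (b2n (f zero ∧ not (g zero))) _ _)
  where
  b2n-split : ∀ a b → b2n a ≡ b2n (a ∧ b) + b2n (a ∧ not b)
  b2n-split true  true  = refl
  b2n-split true  false = refl
  b2n-split false b     = refl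

count-disjoint-≤ : ∀ {n} (f g h : Fin n → Bool) →
  (∀ x → f x ≡ true → h x ≡ true) → (∀ x → g x ≡ true → h x ≡ true) →
  (∀ x → f x ≡ true → g x ≡ false) → count f + count g ≤ count h
count-disjoint-≤ f g h f⊆h g⊆h disj =
  ≤-trans (+-mono-≤ (count-mono {g = λ x → h x ∧ f x} (λ x p → ∧-intro (f⊆h x p) p))
                    (count-mono {g = λ x → h x ∧ not (f x)}
                      (λ x p → ∧-intro (g⊆h x p) (not-intro (¬true⇒false (λ q → tf-absurd p (disj x q)))))))
    (≤-reflexive (sym (count-split h f)))

count-empty : ∀ {n} → count {n} (λ _ → false) ≡ 0
count-empty {zero}  = refl
count-empty {suc n} = count-empty {n}

count-full : ∀ {n} → count {n} (λ _ → true) ≡ n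
count-full {zero}  = refl
count-full {suc n} = cong suc (count-full {n})

count-≤ : ∀ {n} (f : Fin n → Bool) → count f ≤ n
count-≤ {n} f = ≤-trans (count-mono {f = f} {g = λ _ → true} (λ _ _ → refl)) (≤-reflexive (count-full {n}))

count-pos : ∀ {n} (f : Fin n → Bool) → 1 ≤ count f → ∃ λ x → f x ≡ true
count-pos {n} f p with bool (any f)
... | inj₁ q = any-elim f q
... | inj₂ q = ⊥-elim (1+n≰n (≤-trans p (≤-trans
                 (count-mono {f = f} {g = λ _ → false} (λ x r → tf-absurd r (any-false f q x)))
                 (≤-reflexive (count-empty {n})))))

count-punchIn : ∀ {n} (f : Fin (suc n) → Bool) i → count f ≡ b2n (f i) + count (f ∘ punchIn i)
count-punchIn f zero = refl
count-punchIn {suc n} f (suc i) =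
  trans (cong (b2n (f zero) +_) (count-punchIn (f ∘ suc) i))
    (trans (sym (+-assoc (b2n (f zero)) (b2n (f (suc i))) _))
      (trans (cong (_+ count (f ∘ suc ∘ punchIn i)) (+-comm (b2n (f zero)) (b2n (f (suc i)))))
        (+-assoc (b2n (f (suc i))) (b2n (f zero)) _)))

count-singleton : ∀ {n} (v : Fin n) → count (v ==_) ≡ 1
count-singleton {suc n} v =
  trans (count-punchIn (v ==_) v)
    (cong₂ _+_ (cong b2n (≡⇒== {x = v} refl))
      (trans (count-cong (λ x → ≢⇒== (λ q → punchInᵢ≢i v x (sym q)))) (count-empty {n})))

count-insert : ∀ {n} (v : Fin n) (S : Fin n → Bool) → S v ≡ false → count (insert v S) ≡ suc (count S)
count-insert {suc n} v S p = trans (count-punchIn (insert v S) v)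
  (trans (cong₂ _+_ (cong b2n (insert-new v S)) (count-cong λ x →
      lemma (S (punchIn v x)) (≢⇒== (λ q → punchInᵢ≢i v x (sym q)))))
    (cong suc (sym (trans (count-punchIn S v) (cong (λ z → b2n z + count (S ∘ punchIn v)) p)))))
  where
  lemma : ∀ a {b} → b ≡ false → a ∨ b ≡ a
  lemma true  _ = refl
  lemma false q = q

count-strict : ∀ {n} {f g : Fin n → Bool} → (∀ x → f x ≡ true → g x ≡ true) →
  ∀ v → f v ≡ false → g v ≡ true → count f < count g
count-strict {f = f} {g} f⊆g v fv gv =
  ≤-trans (≤-reflexive (sym (count-insert v f fv)))
    (count-mono {f = insert v f} λ x p → case insert-elim v f p of λ
      { (inj₁ q) → f⊆g x q ; (inj₂ refl) → gv })

-- The union bound behind the two size estimates: the edges on the routes of selected tokens, and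
-- the edges discarded because of a chosen theta.
count-∃ : ∀ {n m} (g : Fin n → Bool) (h : Fin n → Fin m → Bool) {b} →
  (∀ i → g i ≡ true → count (h i) ≤ b) →
  count (λ e → any (λ i → g i ∧ h i e)) ≤ count g * b
count-∃ {zero} {m} g h p = ≤-reflexive (count-empty {m})
count-∃ {suc n} {m} g h {b} p =
  ≤-trans (count-∨ (λ e → g zero ∧ h zero e) (λ e → any (λ i → g (suc i) ∧ h (suc i) e)))
    (≤-trans (+-mono-≤ (head (g zero) refl) (count-∃ (g ∘ suc) (h ∘ suc) (λ i → p (suc i))))
      (≤-reflexive (sym (*-distribʳ-+ b (b2n (g zero)) (count (g ∘ suc))))))
  where
  head : ∀ a → g zero ≡ a → count (λ e → a ∧ h zero e) ≤ b2n a * b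
  head true  q = ≤-trans (p zero q) (≤-reflexive (sym (*-identityˡ b)))
  head false q = ≤-reflexive (count-empty {m})

subset-of-size : ∀ {n} (f : Fin n → Bool) r → r ≤ count f →
  Σ (Fin n → Bool) λ g → (∀ x → g x ≡ true → f x ≡ true) × count g ≡ r
subset-of-size {n} f zero p = (λ _ → false) , (λ _ ()) , count-empty {n}
subset-of-size f (suc r) p with subset-of-size f r (≤-trans (n≤1+n r) p)
... | g , g⊆f , refl with count-pos (λ x → f x ∧ not (g x))
        (+-cancelˡ-≤ (count g) 1 _ (≤-trans (≤-reflexive (+-comm (count g) 1)) (≤-trans p
          (≤-trans (≤-reflexive (count-split f g))
            (+-monoˡ-≤ _ (count-mono (λ x q → proj₂ (∧-elim (f x) q))))))))
...   | x , q = insert x g ,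
                (λ y s → case insert-elim x g s of λ
                  { (inj₁ t) → g⊆f y t ; (inj₂ refl) → proj₁ (∧-elim (f x) q) }) ,
                count-insert x g (not-elim (proj₂ (∧-elim (f x) q)))

enum : ∀ {n} (f : Fin n → Bool) → Fin (count f) → Fin n
enum {suc n} f i with f zero
enum {suc n} f zero    | true  = zero
enum {suc n} f (suc i) | true  = suc (enum (f ∘ suc) i)
enum {suc n} f i       | false = suc (enum (f ∘ suc) i)

enum-∈ : ∀ {n} (f : Fin n → Bool) i → f (enum f i) ≡ true
enum-∈ {suc n} f i with f zero in eq
enum-∈ {suc n} f zero    | true  = eq
enum-∈ {suc n} f (suc i) | true  = enum-∈ (f ∘ suc) i
enum-∈ {suc n} f i       | false = enum-∈ (f ∘ suc) i

enum-injective : ∀ {n} (f : Fin n → Bool) {i j} → enum f i ≡ enum f j → i ≡ j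
enum-injective {suc n} f {i} {j} p with f zero
enum-injective {suc n} f {zero}  {zero}  p | true = refl
enum-injective {suc n} f {suc i} {suc j} p | true = cong suc (enum-injective (f ∘ suc) (suc-injective p))
enum-injective {suc n} f {i} {j} p | false = enum-injective (f ∘ suc) (suc-injective p)

index : ∀ {n} (f : Fin n → Bool) x → f x ≡ true → ∃ λ i → enum f i ≡ x
index {suc n} f x p with f zero in eq
index {suc n} f zero p | true = zero , refl
index {suc n} f (suc x) p | true with index (f ∘ suc) x p
... | i , q = suc i , cong suc q
index {suc n} f zero p | false = tf-absurd p eq
index {suc n} f (suc x) p | false with index (f ∘ suc) x p
... | i , q = i , cong suc q

count-enum : ∀ {n} (f g : Fin n → Bool) → count (g ∘ enum f) ≡ count (λ x → f x ∧ g x)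
count-enum {zero} f g = refl
count-enum {suc n} f g with f zero
... | true  = cong (b2n (g zero) +_) (count-enum (f ∘ suc) (g ∘ suc))
... | false = count-enum (f ∘ suc) (g ∘ suc)

-- Connectivity, thetas and forests

module _ {n m} (G : Graph n m) where

  src tgt : Fin m → Fin n
  src e = proj₁ (G e)
  tgt e = proj₂ (G e)

  -- The monochromatic edges are those that may be contracted; the others form the cut of the
  -- colouring. Loops are always monochromatic.
  mono : (Fin n → Bool) → Fin m → Bool
  mono χ e = eqb (χ (src e)) (χ (tgt e))

  inside : (Fin n → Bool) → Fin m → Bool
  inside S e = S (src e) ∧ S (tgt e)

  data Joins (e : Fin m) : Fin n → Fin n → Set where
    fwd : Joins e (src e) (tgt e)
    bwd : Joins e (tgt e) (src e)

  data Conn (P : Fin m → Bool) : Fin n → Fin n → Set where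
    []   : ∀ {x} → Conn P x x
    edge : ∀ {x y z} e → P e ≡ true → Joins e x y → Conn P y z → Conn P x z

module _ {n m} {G : Graph n m} where

  joins-sym : ∀ {e x y} → Joins G e x y → Joins G e y x
  joins-sym fwd = bwd
  joins-sym bwd = fwd

  joins⇒ends : (Z : Fin n → Set) → ∀ {e x y} → Joins G e x y → Z x → Z y → Z (src G e) × Z (tgt G e)
  joins⇒ends Z fwd zx zy = zx , zy
  joins⇒ends Z bwd zx zy = zy , zx

  ends⇒joins : (Z : Fin n → Set) → ∀ {e x y} → Joins G e x y → Z (src G e) → Z (tgt G e) → Z x × Z y
  ends⇒joins Z fwd zx zy = zx , zy
  ends⇒joins Z bwd zx zy = zy , zx

  joins-mono : ∀ {χ e x y} → Joins G e x y → mono G χ e ≡ true → χ x ≡ χ y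
  joins-mono fwd p = eqb⇒≡ p
  joins-mono bwd p = sym (eqb⇒≡ p)

  mono-joins : ∀ {χ e x y} → Joins G e x y → χ x ≡ χ y → mono G χ e ≡ true
  mono-joins fwd p = ≡⇒eqb p
  mono-joins bwd p = ≡⇒eqb (sym p)

  joins-inside : ∀ S {e x y} → Joins G e x y → inside G S e ≡ true → S x ≡ true × S y ≡ true
  joins-inside S {e} j p with ∧-elim (S (src G e)) p
  ... | s , t = ends⇒joins (λ z → S z ≡ true) j s t

  inside-joins : ∀ S {e x y} → Joins G e x y → S x ≡ true → S y ≡ true → inside G S e ≡ true
  inside-joins S j sx sy with joins⇒ends (λ z → S z ≡ true) j sx sy
  ... | s , t = ∧-intro s t

  _++_ : ∀ {P x y z} → Conn G P x y → Conn G P y z → Conn G P x z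
  []             ++ d = d
  edge e p j c ++ d = edge e p j (c ++ d)

  conn-edge : ∀ {P x y} e → P e ≡ true → Joins G e x y → Conn G P x y
  conn-edge e p j = edge e p j []

  conn-sym : ∀ {P x y} → Conn G P x y → Conn G P y x
  conn-sym []             = []
  conn-sym (edge e p j c) = conn-sym c ++ conn-edge e p (joins-sym j)

  conn-ind : ∀ {P} (Z : Fin n → Set) → (∀ {e x y} → P e ≡ true → Joins G e x y → Z x → Z y) →
    ∀ {x y} → Conn G P x y → Z x → Z y
  conn-ind Z h []             z = z
  conn-ind Z h (edge e p j c) z = conn-ind Z h c (h p j z)

  conn-⊆ : ∀ {P P′} → (∀ e → P e ≡ true → P′ e ≡ true) → ∀ {x y} → Conn G P x y → Conn G P′ x y
  conn-⊆ h []             = []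
  conn-⊆ h (edge e p j c) = edge e (h e p) j (conn-⊆ h c)

  conn-mono : ∀ {P χ} → (∀ e → P e ≡ true → mono G χ e ≡ true) → ∀ {x y} → Conn G P x y → χ x ≡ χ y
  conn-mono {χ = χ} h {x} c = conn-ind (λ y → χ x ≡ χ y) (λ {e} p j q → trans q (joins-mono j (h e p))) c refl

module _ {n m n′ m′} {G : Graph n m} {G′ : Graph n′ m′} where

  conn-map : ∀ {P P′} (φ : Fin n → Fin n′) →
    (∀ {e x y} → P e ≡ true → Joins G e x y → Conn G′ P′ (φ x) (φ y)) →
    ∀ {x y} → Conn G P x y → Conn G′ P′ (φ x) (φ y)
  conn-map φ h []             = []
  conn-map φ h (edge e p j c) = h p j ++ conn-map φ h c

-- G has a θᵣ model with edges in P: χ splits the vertices into two sides, a and b represent the contracted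
-- vertices, and each of the at least r edges of tok joins the part of one side connected to a with the part
-- of the other side connected to b.
record Theta {n m} (G : Graph n m) (P : Fin m → Bool) (r : ℕ) : Set where
  field
    χ      : Fin n → Bool
    a b    : Fin n
    tok    : Fin m → Bool
    tok⊆   : ∀ e → tok e ≡ true → P e ≡ true
    enough : r ≤ count tok
    cross  : ∀ e → tok e ≡ true → mono G χ e ≡ false
    ends   : ∀ e → tok e ≡ true → ∃ λ x → ∃ λ y → Joins G e x y ×
               Conn G (λ f → P f ∧ mono G χ f) a x × Conn G (λ f → P f ∧ mono G χ f) b y

module _ {n m} {G : Graph n m} where

  theta-⊆ : ∀ {P P′ r} → (∀ e → P e ≡ true → P′ e ≡ true) → Theta G P r → Theta G P′ r
  theta-⊆ {P} h θ = record
    { χ = χ ; a = a ; b = b ; tok = tok ; tok⊆ = λ e p → h e (tok⊆ e p) ; enough = enough ; cross = cross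
    ; ends = λ e p → case ends e p of λ
        { (x , y , j , c , d) → x , y , j , conn-⊆ h′ c , conn-⊆ h′ d } }
    where
    open Theta θ
    h′ : ∀ e → P e ∧ mono G χ e ≡ true → _
    h′ e p with ∧-elim (P e) p
    ... | q , s = ∧-intro (h e q) s

  theta-swap : ∀ {P r} → Theta G P r → Theta G P r
  theta-swap θ = record
    { χ = χ ; a = b ; b = a ; tok = tok ; tok⊆ = tok⊆ ; enough = enough ; cross = cross
    ; ends = λ e p → case ends e p of λ { (x , y , j , c , d) → y , x , joins-sym j , d , c } }
    where open Theta θ

  theta-token : ∀ {P r} → 1 ≤ r → (θ : Theta G P r) → ∃ λ e → Theta.tok θ e ≡ true
  theta-token r≥1 θ = count-pos tok (≤-trans r≥1 enough)
    where open Theta θ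

  theta-sides : ∀ {P r} → 1 ≤ r → (θ : Theta G P r) → Theta.χ θ (Theta.a θ) ≢ Theta.χ θ (Theta.b θ)
  theta-sides {P} r≥1 θ q with theta-token r≥1 θ
  ... | e , t with Theta.ends θ e t
  ...   | x , y , j , c , d = tf-absurd (mono-joins {χ = χ} j
           (trans (sym (conn-mono in-mono c)) (trans q (conn-mono in-mono d)))) (cross e t)
    where
    open Theta θ
    in-mono : ∀ f → P f ∧ mono G χ f ≡ true → mono G χ f ≡ true
    in-mono f s = proj₂ (∧-elim (P f) s)

-- A forest is encoded by its construction history, one leaf at a time from the roots `R`. Recursion
-- on the history removes leaves in reverse order, which is the form that the merging arguments
-- need, and acyclicity never has to be stated.
data Forest {n m} (G : Graph n m) (P : Fin m → Bool) (R : Fin n → Bool) :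
            (Fin n → Bool) → (Fin m → Bool) → Set where
  base : Forest G P R R (λ _ → false)
  leaf : ∀ {S E} → Forest G P R S E → ∀ p v e → S p ≡ true → S v ≡ false →
         P e ≡ true → Joins G e p v → Forest G P R (insert v S) (insert e E)

module _ {n m} {G : Graph n m} {P : Fin m → Bool} {R : Fin n → Bool} where

  roots⊆ : ∀ {S E} → Forest G P R S E → ∀ x → R x ≡ true → S x ≡ true
  roots⊆ base x p = p
  roots⊆ (leaf {S} F q v e _ _ _ _) x p = insert-old v S (roots⊆ F x p)

  forest-edges : ∀ {S E} → Forest G P R S E → ∀ e → E e ≡ true → P e ≡ true × inside G S e ≡ true
  forest-edges (leaf {S} {E} F p v e sp sv pe j) f q with insert-elim e E q
  ... | inj₂ refl = pe , inside-joins (insert v S) j (insert-old v S sp) (insert-new v S)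
  ... | inj₁ q′ with forest-edges F f q′
  ...   | pf , i with joins-inside {G = G} S {f} fwd i
  ...     | s , t = pf , ∧-intro (insert-old v S s) (insert-old v S t)

  -- The new edge is not yet in `E` because its end `v` lies outside `S`, so edges and vertices grow
  -- together. This count stands in for acyclicity.
  forest-count : ∀ {S E} → Forest G P R S E → count E + count R ≡ count S
  forest-count base = cong (_+ count R) (count-empty {m})
  forest-count (leaf {S} {E} F p v e sp sv pe j) =
    trans (cong (_+ count R) (count-insert e E (¬true⇒false λ q →
        tf-absurd (proj₂ (joins-inside S j (proj₂ (forest-edges F e q)))) sv)))
      (trans (cong suc (forest-count F)) (sym (count-insert v S sv)))

  -- Vertices outside the forest get the dummy value 0.
  depth : ∀ {S E} → Forest G P R S E → Fin n → ℕ
  depth base x = 0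
  depth (leaf F p v e _ _ _ _) x = if v == x then suc (depth F p) else depth F x

  -- The path is kept as an edge set `π`, since all later estimates count edges.
  root-path : ∀ {S E} (F : Forest G P R S E) x → S x ≡ true →
    ∃ λ ρ → Σ (Fin m → Bool) λ π → R ρ ≡ true × count π ≤ depth F x ×
      (∀ e → π e ≡ true → E e ≡ true) × Conn G π x ρ
  root-path base x p = x , (λ _ → false) , p , ≤-reflexive (count-empty {m}) , (λ _ ()) , []
  root-path (leaf {S} {E} F p v e sp sv pe j) x q with v ≟ x | insert-elim v S q
  ... | no ¬eq | inj₂ eq = ⊥-elim (¬eq eq)
  ... | no ¬eq | inj₁ sx with root-path F x sx
  ...   | ρ , π , ρ∈ , len , sub , c = ρ , π , ρ∈ , len , (λ f z → insert-old e E (sub f z)) , c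
  root-path (leaf {S} {E} F p v e sp sv pe j) x q | yes refl | _ with root-path F p sp
  ...   | ρ , π , ρ∈ , len , sub , c =
    ρ , insert e π , ρ∈ ,
    ≤-trans (count-∨ π (e ==_)) (≤-trans (≤-reflexive (trans (cong (count π +_) (count-singleton e)) (+-comm (count π) 1))) (s≤s len)) ,
    (λ f z → case insert-elim e π z of λ
      { (inj₁ y) → insert-old e E (sub f y) ; (inj₂ refl) → insert-new e E }) ,
    edge e (insert-new e π) (joins-sym j) (conn-⊆ (λ f → insert-old e π) c)

  Closed : (Fin n → Bool) → Set
  Closed S = ∀ {e x y} → P e ≡ true → Joins G e x y → S x ≡ true → S y ≡ true

  grow : ∀ {S E} → Forest G P R S E → Σ (Fin n → Bool) λ S′ → Σ (Fin m → Bool) λ E′ →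
    Forest G P R S′ E′ × Closed S′
  grow {S} F = go n F (m≤n+m n (count S))
    where
    go : ∀ k {S E} → Forest G P R S E → n ≤ count S + k → Σ (Fin n → Bool) λ S′ → Σ (Fin m → Bool) λ E′ →
      Forest G P R S′ E′ × Closed S′
    next : ∀ k {S E} → Forest G P R S E → n ≤ count S + k → ∀ p v e → S p ≡ true → S v ≡ false →
      P e ≡ true → Joins G e p v → Σ (Fin n → Bool) λ S′ → Σ (Fin m → Bool) λ E′ →
      Forest G P R S′ E′ × Closed S′
    go k {S} {E} F h with bool (any (λ e → P e ∧ not (mono G S e)))
    ... | inj₂ none = S , E , F , λ {e} {x} {y} pe j sx →
            case bool (mono G S e) of λ
              { (inj₁ q) → trans (sym (joins-mono {χ = S} j q)) sx
              ; (inj₂ q) → tf-absurd (∧-intro pe (not-intro q)) (any-false _ none e) }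
    ... | inj₁ some with any-elim _ some
    ...   | e , q with ∧-elim (P e) q
    ...     | pe , ne with bool (S (src G e)) | bool (S (tgt G e))
    ...       | inj₁ s | inj₁ t = tf-absurd (≡⇒eqb (trans s (sym t))) (not-elim ne)
    ...       | inj₂ s | inj₂ t = tf-absurd (≡⇒eqb (trans s (sym t))) (not-elim ne)
    ...       | inj₁ s | inj₂ t = next k F h _ _ e s t pe fwd
    ...       | inj₂ s | inj₁ t = next k F h _ _ e t s pe bwd
    next zero {S} F h p v e sp sv pe j =
      ⊥-elim (1+n≰n (≤-trans (≤-trans (≤-reflexive (sym (count-insert v S sv))) (count-≤ (insert v S)))
        (≤-trans h (≤-reflexive (+-identityʳ (count S))))))
    next (suc k) {S} F h p v e sp sv pe j = go k (leaf F p v e sp sv pe j)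
      (≤-trans h (≤-reflexive (trans (+-suc (count S) k) (cong (_+ k) (sym (count-insert v S sv))))))

-- Decidability of reachability and of thetas

module _ {n m} (G : Graph n m) where

  -- Makes reachability a Boolean set by growing a maximal tree from `a`: root paths give soundness,
  -- closure under `P`-edges gives completeness.
  reach : ∀ P a → Σ (Fin n → Bool) λ S → (∀ x → S x ≡ true → Conn G P a x) × (∀ {x} → Conn G P a x → S x ≡ true)
  reach P a with grow {G = G} {P} {a ==_} base
  ... | S , E , F , closed = S , sound , λ c → conn-ind (λ y → S y ≡ true) closed c (roots⊆ F a (≡⇒== {x = a} refl))
    where
    sound : ∀ x → S x ≡ true → Conn G P a x
    sound x p with root-path F x p
    ... | ρ , π , ρ∈ , _ , sub , c with ==⇒≡ a ρ ρ∈
    ...   | refl = conn-sym (conn-⊆ (λ e q → proj₁ (forest-edges F e (sub e q))) c)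

  private
    mono-part : (Fin m → Bool) → (Fin n → Bool) → Fin m → Bool
    mono-part P χ f = P f ∧ mono G χ f

    reachable : (Fin m → Bool) → (Fin n → Bool) → Fin n → Fin n → Bool
    reachable P χ a = proj₁ (reach (mono-part P χ) a)

    -- The largest possible token set for given `χ`, `a` and `b`. Hence a search for a theta need
    -- not range over token sets.
    crossing-edges : (Fin m → Bool) → (Fin n → Bool) → Fin n → Fin n → Fin m → Bool
    crossing-edges P χ a b e = (P e ∧ not (mono G χ e)) ∧
      ((reachable P χ a (src G e) ∧ reachable P χ b (tgt G e)) ∨ (reachable P χ a (tgt G e) ∧ reachable P χ b (src G e)))

    edges⇒theta : ∀ P χ a b r → r ≤ count (crossing-edges P χ a b) → Theta G P r
    edges⇒theta P χ a b r h = record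
      { χ = χ ; a = a ; b = b ; tok = crossing-edges P χ a b ; enough = h
      ; tok⊆ = λ e p → proj₁ (∧-elim (P e) (proj₁ (∧-elim (P e ∧ _) p)))
      ; cross = λ e p → not-elim (proj₂ (∧-elim (P e) (proj₁ (∧-elim (P e ∧ _) p))))
      ; ends = ends }
      where
      ends : ∀ e → crossing-edges P χ a b e ≡ true → ∃ λ x → ∃ λ y → Joins G e x y ×
               Conn G (mono-part P χ) a x × Conn G (mono-part P χ) b y
      ends e p with ∨-elim (reachable P χ a (src G e) ∧ reachable P χ b (tgt G e)) (proj₂ (∧-elim (P e ∧ not (mono G χ e)) p))
      ... | inj₁ q with ∧-elim (reachable P χ a (src G e)) q
      ...   | u , v = _ , _ , fwd ,
                      proj₁ (proj₂ (reach (mono-part P χ) a)) _ u , proj₁ (proj₂ (reach (mono-part P χ) b)) _ v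
      ends e p | inj₂ q with ∧-elim (reachable P χ a (tgt G e)) q
      ...   | u , v = _ , _ , bwd ,
                      proj₁ (proj₂ (reach (mono-part P χ) a)) _ u , proj₁ (proj₂ (reach (mono-part P χ) b)) _ v

    -- The search in `theta?` runs over vectors, so the colouring is replaced by a tabulated copy
    -- that agrees with it pointwise.
    theta⇒edges : ∀ {P r} (θ : Theta G P r) χ → (∀ x → Theta.χ θ x ≡ χ x) →
      r ≤ count (crossing-edges P χ (Theta.a θ) (Theta.b θ))
    theta⇒edges {P} θ χ′ same = ≤-trans enough (count-mono incl)
      where
      open Theta θ
      same-mono : ∀ e → mono G χ e ≡ mono G χ′ e
      same-mono e = cong₂ eqb (same (src G e)) (same (tgt G e))
      hit : ∀ {a x} → Conn G (mono-part P χ) a x → reachable P χ′ a x ≡ true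
      hit {a} c = proj₂ (proj₂ (reach (mono-part P χ′) a))
        (conn-⊆ (λ e p → trans (cong (P e ∧_) (sym (same-mono e))) p) c)
      incl : ∀ e → tok e ≡ true → crossing-edges P χ′ a b e ≡ true
      incl e p with ends e p
      ... | x , y , j , c , d = ∧-intro
            (∧-intro (tok⊆ e p) (not-intro (trans (sym (same-mono e)) (cross e p)))) (side j c d)
        where
        side : ∀ {x y} → Joins G e x y → Conn G (mono-part P χ) a x → Conn G (mono-part P χ) b y →
          (reachable P χ′ a (src G e) ∧ reachable P χ′ b (tgt G e)) ∨ (reachable P χ′ a (tgt G e) ∧ reachable P χ′ b (src G e)) ≡ true
        side fwd c d = ∨-introˡ (∧-intro (hit c) (hit d))
        side bwd c d = ∨-introʳ (reachable P χ′ a (src G e) ∧ _) (∧-intro (hit c) (hit d))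

  theta? : ∀ P r → Dec (Theta G P r)
  theta? P r with anySubset? (λ s → any? (λ a → any? (λ b → r ≤? count (crossing-edges P (lookup s) a b))))
  ... | yes (s , a , b , h) = yes (edges⇒theta P (lookup s) a b r h)
  ... | no none = no λ θ → none (tabulate (Theta.χ θ) , Theta.a θ , Theta.b θ ,
          theta⇒edges θ _ (λ x → sym (lookup∘tabulate (Theta.χ θ) x)))

-- Models and thetas

punchIn-merge : ∀ {n} (u v : Fin (suc n)) (ne : u ≢ v) w →
  (w ≡ v × punchIn v (merge u v ne w) ≡ u) ⊎ punchIn v (merge u v ne w) ≡ w
punchIn-merge u v ne w with w ≟ v
... | yes p = inj₁ (p , punchIn-punchOut _)
... | no _  = inj₂ (punchIn-punchOut _)

merge-punchIn : ∀ {n} (u v : Fin (suc n)) (ne : u ≢ v) w → merge u v ne (punchIn v w) ≡ w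
merge-punchIn u v ne w with punchIn v w ≟ v
... | yes p = ⊥-elim (punchInᵢ≢i v w p)
... | no _  = trans (punchOut-cong v refl) (punchOut-punchIn v)

merge-ends : ∀ {n} (u v : Fin (suc n)) (ne : u ≢ v) → merge u v ne u ≡ merge u v ne v
merge-ends u v ne with u ≟ v | v ≟ v
... | yes p | _     = ⊥-elim (ne p)
... | no _  | yes _ = punchOut-cong v refl
... | no _  | no ¬p = ⊥-elim (¬p refl)

module _ {n m} (G : Graph (suc n) (suc m)) (e : Fin (suc m)) (ne : src G e ≢ tgt G e) where

  private
    collapse : Fin (suc n) → Fin n
    collapse = merge (src G e) (tgt G e) ne

    section : Fin n → Fin (suc n)
    section = punchIn (tgt G e)

    split-conn : ∀ {P} → P e ≡ true → ∀ w → Conn G P w (section (collapse w))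
    split-conn p w with punchIn-merge (src G e) (tgt G e) ne w
    ... | inj₂ q = subst (Conn G _ w) (sym q) []
    ... | inj₁ (refl , q) = subst (Conn G _ w) (sym q) (conn-edge e p bwd)

  -- The colouring is pulled back, which makes `e` monochromatic. Since `section` never returns the
  -- end of `e` that was merged away, a lifted walk takes a detour over `e` whenever an edge is
  -- attached to that end.
  uncontract-theta : ∀ {r} → Theta (contract G e ne) (λ _ → true) r → Theta G (λ _ → true) r
  uncontract-theta {r} θ = record
    { χ = χ ∘ collapse ; a = section a ; b = section b ; tok = tok′ ; tok⊆ = λ _ _ → refl
    ; enough = ≤-trans enough (≤-reflexive (sym tok′-count))
    ; cross = λ f p → case tok′-elim f p of λ { (g , refl , t) → cross g t }
    ; ends = λ f p → case tok′-elim f p of λ { (g , refl , t) → case ends g t of λ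
        { (_ , _ , fwd , c , d) → _ , _ , fwd , conn-pull c ++ conn-sym (split-conn e-mono _) , conn-pull d ++ conn-sym (split-conn e-mono _)
        ; (_ , _ , bwd , c , d) → _ , _ , bwd , conn-pull c ++ conn-sym (split-conn e-mono _) , conn-pull d ++ conn-sym (split-conn e-mono _) } } }
    where
    open Theta θ
    tok′ : Fin (suc m) → Bool
    tok′ f with e ≟ f
    ... | yes _ = false
    ... | no e≢f = tok (punchOut e≢f)
    tok′-elim : ∀ f → tok′ f ≡ true → ∃ λ g → punchIn e g ≡ f × tok g ≡ true
    tok′-elim f p with e ≟ f
    ... | no e≢f = punchOut e≢f , punchIn-punchOut e≢f , p
    tok′-e : tok′ e ≡ false
    tok′-e with e ≟ e
    ... | yes _ = refl
    ... | no ¬p = ⊥-elim (¬p refl)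
    tok′-punchIn : ∀ g → tok′ (punchIn e g) ≡ tok g
    tok′-punchIn g with e ≟ punchIn e g
    ... | yes q = ⊥-elim (punchInᵢ≢i e g (sym q))
    ... | no _  = cong tok (trans (punchOut-cong e refl) (punchOut-punchIn e))
    tok′-count : count tok′ ≡ count tok
    tok′-count = trans (count-punchIn tok′ e) (cong₂ _+_ (cong b2n tok′-e) (count-cong tok′-punchIn))
    e-mono : true ∧ mono G (χ ∘ collapse) e ≡ true
    e-mono = ≡⇒eqb (cong χ (merge-ends (src G e) (tgt G e) ne))
    conn-pull : ∀ {x y} → Conn (contract G e ne) (λ f → true ∧ mono (contract G e ne) χ f) x y →
      Conn G (λ f → true ∧ mono G (χ ∘ collapse) f) (section x) (section y)
    conn-pull = conn-map section λ
      { {f} p fwd → conn-sym (split-conn e-mono _) ++ (conn-edge (punchIn e f) p fwd ++ split-conn e-mono _)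
      ; {f} p bwd → conn-sym (split-conn e-mono _) ++ (conn-edge (punchIn e f) p bwd ++ split-conn e-mono _) }

  contract-colour : (χ : Fin (suc n) → Bool) → χ (src G e) ≡ χ (tgt G e) → ∀ w → χ (section (collapse w)) ≡ χ w
  contract-colour χ q w with punchIn-merge (src G e) (tgt G e) ne w
  ... | inj₂ p = cong χ p
  ... | inj₁ (refl , p) = trans (cong χ p) q

  contract-conn : (χ : Fin (suc n) → Bool) → χ (src G e) ≡ χ (tgt G e) → ∀ {x y} → Conn G (mono G χ) x y →
    Conn (contract G e ne) (mono (contract G e ne) (χ ∘ section)) (collapse x) (collapse y)
  contract-conn χ q = conn-map collapse λ {f} p j → push f p j
    where
    push : ∀ f {x y} → mono G χ f ≡ true → Joins G f x y →
      Conn (contract G e ne) (mono (contract G e ne) (χ ∘ section)) (collapse x) (collapse y)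
    push f p j with e ≟ f
    push f p fwd | yes refl = subst (Conn _ _ _) (merge-ends _ _ ne) []
    push f p bwd | yes refl = subst (Conn _ _ _) (sym (merge-ends _ _ ne)) []
    push f p j | no e≢f with punchOut e≢f | punchIn-punchOut e≢f
    push f p fwd | no e≢f | g | refl = conn-edge g (≡⇒eqb (trans (contract-colour χ q _) (trans (eqb⇒≡ p) (sym (contract-colour χ q _))))) fwd
    push f p bwd | no e≢f | g | refl = conn-edge g (≡⇒eqb (trans (contract-colour χ q _) (trans (eqb⇒≡ p) (sym (contract-colour χ q _))))) bwd

contracts⇒theta : ∀ {r n m} {G : Graph n m} → ContractsTo r G → Theta G (λ _ → true) r
contracts⇒theta (step {G = G} e ne c) = uncontract-theta G e ne (contracts⇒theta c)
contracts⇒theta {r} {n} {m} {G} (done iso) = record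
  { χ = λ w → zero == to vmap w ; a = from vmap zero ; b = from vmap (suc zero) ; tok = λ _ → true
  ; tok⊆ = λ _ _ → refl
  ; enough = ≤-trans (injective⇒≤ {f = from emap} λ {x} {y} p →
      trans (sym (strictlyInverseˡ emap x)) (trans (cong (to emap) p) (strictlyInverseˡ emap y)))
      (≤-reflexive (sym (count-full {m})))
  ; cross = λ e _ → case preserves e of λ
      { (inj₁ (p , q)) → ≢⇒eqb (apart p q)
      ; (inj₂ (p , q)) → ≢⇒eqb (apart p q ∘ sym) }
  ; ends = λ e _ → case preserves e of λ
      { (inj₁ (p , q)) → _ , _ , fwd , at p , at q
      ; (inj₂ (p , q)) → _ , _ , bwd , at p , at q } }
  where
  open Iso iso
  open Inverse
  apart : ∀ {x y : Fin 2} → zero ≡ x → suc zero ≡ y → (zero == x) ≢ (zero == y)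
  apart refl refl ()
  at : ∀ {P i x} → i ≡ to vmap x → Conn G P (from vmap i) x
  at {x = x} refl = subst (Conn G _ (from vmap (to vmap x))) (strictlyInverseʳ vmap x) []

-- The set `P` is free so that a model missing a candidate cover becomes a theta in the complement
-- of that cover. Vertices outside the model are coloured `false`.
model⇒theta : ∀ {n m} {G : Graph n m} {r} (M : Model G r) (P : Fin m → Bool) →
  (∀ e → P (Model.eemb M e) ≡ true) → Theta G P r
model⇒theta {n} {m} {G} {r} M P h = record
  { χ = χ′ ; a = vemb a ; b = vemb b ; tok = tok′
  ; tok⊆ = λ e p → case tok′-elim e p of λ { (f , refl , _) → h f }
  ; enough = ≤-trans enough (count-image eemb einj tok tok′ λ f t → any-intro (λ i → tok i ∧ (eemb i == eemb f)) f (∧-intro t (≡⇒== {x = eemb f} refl)))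
  ; cross = λ e p → case tok′-elim e p of λ { (f , refl , t) → trans (mono-emb f) (cross f t) }
  ; ends = λ e p → case tok′-elim e p of λ { (f , refl , t) → case ends f t of λ
      { (x , y , j , c , d) → _ , _ , joins-emb j , conn-emb c , conn-emb d } } }
  where
  open Model M
  open Theta (contracts⇒theta contracts)
  χ′ : Fin n → Bool
  χ′ y = any (λ i → χ i ∧ (vemb i == y))
  χ′-emb : ∀ x → χ′ (vemb x) ≡ χ x
  χ′-emb x with bool (χ x)
  ... | inj₁ p = trans (any-intro (λ i → χ i ∧ (vemb i == vemb x)) x (∧-intro p (≡⇒== {x = vemb x} refl))) (sym p)
  ... | inj₂ p = trans (¬true⇒false λ q → case any-elim _ q of λ
          { (i , s) → case ∧-elim (χ i) s of λ { (t , u) → tf-absurd t (trans (cong χ (vinj (==⇒≡ _ _ u))) p) } }) (sym p)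
  tok′ : Fin m → Bool
  tok′ e = any (λ i → tok i ∧ (eemb i == e))
  tok′-elim : ∀ e → tok′ e ≡ true → ∃ λ f → eemb f ≡ e × tok f ≡ true
  tok′-elim e p with any-elim _ p
  ... | f , q with ∧-elim (tok f) q
  ...   | t , s = f , ==⇒≡ _ _ s , t
  count-image : ∀ {k l} (φ : Fin k → Fin l) → (∀ {x y} → φ x ≡ φ y → x ≡ y) → (f : Fin k → Bool) (g : Fin l → Bool) →
    (∀ x → f x ≡ true → g (φ x) ≡ true) → count f ≤ count g
  count-image φ inj f g p = injective⇒≤ {f = λ i → proj₁ (index g (φ (enum f i)) (p _ (enum-∈ f i)))}
    λ {i} {j} q → enum-injective f (inj (trans (sym (proj₂ (index g _ (p _ (enum-∈ f i)))))
      (trans (cong (enum g) q) (proj₂ (index g _ (p _ (enum-∈ f j)))))))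
  mono-emb : ∀ f → mono G χ′ (eemb f) ≡ mono H χ f
  mono-emb f rewrite compat f = cong₂ eqb (χ′-emb _) (χ′-emb _)
  joins-emb : ∀ {f x y} → Joins H f x y → Joins G (eemb f) (vemb x) (vemb y)
  joins-emb {f} fwd = subst₂ (Joins G (eemb f)) (cong proj₁ (compat f)) (cong proj₂ (compat f)) fwd
  joins-emb {f} bwd = subst₂ (Joins G (eemb f)) (cong proj₂ (compat f)) (cong proj₁ (compat f)) bwd
  conn-emb : ∀ {x y} → Conn H (λ f → true ∧ mono H χ f) x y → Conn G (λ f → P f ∧ mono G χ′ f) (vemb x) (vemb y)
  conn-emb = conn-map vemb λ {f} p j → conn-edge (eemb f) (∧-intro (h f) (trans (mono-emb f) p)) (joins-emb j)

-- Supplies the next edge to contract: loops on a walk can be skipped, and a walk between distinct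
-- vertices cannot consist of loops alone.
conn-nonloop : ∀ {n m} {G : Graph n m} {P x y} → Conn G P x y → x ≢ y → ∃ λ e → P e ≡ true × src G e ≢ tgt G e
conn-nonloop [] ne = ⊥-elim (ne refl)
conn-nonloop {G = G} {x = x} (edge {y = y} e p j c) ne with src G e ≟ tgt G e
... | no d = e , p , d
... | yes q with j
...   | fwd = conn-nonloop c (λ s → ne (trans q s))
...   | bwd = conn-nonloop c (λ s → ne (trans (sym q) s))

third-vertex : ∀ {n} (a b : Fin n) → 3 ≤ n → ∃ λ w → a ≢ w × b ≢ w
third-vertex {n} a b h with bool (any (λ w → not ((a == w) ∨ (b == w))))
... | inj₁ p with any-elim _ p
...   | w , q with ∨-false (a == w) (not-elim q)
...     | u , v = w , (λ s → tf-absurd (≡⇒== s) u) , (λ s → tf-absurd (≡⇒== s) v)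
third-vertex {n} a b h | inj₂ p = ⊥-elim (<⇒≱ h (begin
    n                               ≡⟨ sym (count-full {n}) ⟩
    count {n} (λ _ → true)          ≤⟨ count-mono (λ w _ → all w) ⟩
    count (λ w → (a == w) ∨ (b == w)) ≤⟨ count-∨ (a ==_) (b ==_) ⟩
    count (a ==_) + count (b ==_)   ≡⟨ cong₂ _+_ (count-singleton a) (count-singleton b) ⟩
    2                               ∎))
  where
  open ≤-Reasoning
  all : ∀ w → (a == w) ∨ (b == w) ≡ true
  all w with (a == w) ∨ (b == w) | any-false _ p w
  ... | true | _ = refl

isomorphic-θ : ∀ {m} (H : Graph 2 m) → (∀ e → src H e ≢ tgt H e) → Iso H (θ m)
isomorphic-θ H ne = record { vmap = ↔-refl ; emap = ↔-refl ; preserves = λ e → opposite _ _ (ne e) }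
  where
  opposite : (s t : Fin 2) → s ≢ t → SamePair (zero , suc zero) (s , t)
  opposite zero zero ne = ⊥-elim (ne refl)
  opposite zero (suc zero) _ = inj₁ (refl , refl)
  opposite (suc zero) zero _ = inj₂ (refl , refl)
  opposite (suc zero) (suc zero) ne = ⊥-elim (ne refl)

-- By connectivity and the count, the monochromatic edges form spanning trees of the two sides.
-- Contracting one of them lowers both `n` and the count by one and keeps the crossing edges, until
-- two vertices and no monochromatic edge remain.
contractible : ∀ n {m} (H : Graph n m) {r} (χ : Fin n → Bool) (a b : Fin n) → χ a ≢ χ b →
  (∀ w → Conn H (mono H χ) a w ⊎ Conn H (mono H χ) b w) →
  count (mono H χ) + 2 ≡ n → count (λ e → not (mono H χ e)) ≡ r → ContractsTo r H
contractible zero H χ () b _ _ _ _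
contractible (suc zero) H χ a b _ _ cm _ = ⊥-elim (m+1+n≢m 1 (trans (+-comm 2 (count (mono H χ))) cm))
contractible (suc (suc zero)) {m} H χ a b ab _ cm refl = done (subst (Iso H ∘ θ) all-cross
    -- A loop would be monochromatic, and no monochromatic edge is left.
    (isomorphic-θ H λ e q → 1+n≢0 (n≤0⇒n≡0 (≤-trans
      (≤-trans (≤-reflexive (sym (count-singleton e))) (count-mono λ f p → case ==⇒≡ e f p of λ { refl → ≡⇒eqb (cong χ q) }))
      (≤-reflexive no-mono)))))
  where
  no-mono : count (mono H χ) ≡ 0
  no-mono = +-cancelʳ-≡ 2 (count (mono H χ)) 0 cm
  all-cross : m ≡ count (λ e → not (mono H χ e))
  all-cross = trans (sym (count-full {m})) (trans (count-split (λ _ → true) (mono H χ)) (cong (_+ count (λ e → not (mono H χ e))) no-mono))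
contractible (suc (suc (suc n))) {zero} H χ a b ab conn () cn
contractible (suc (suc (suc n))) {suc m} H χ a b ab conn cm cn with third-vertex a b (s≤s (s≤s (s≤s z≤n)))
-- A third vertex is joined to `a` or `b` by a monochromatic walk, and this walk contains an edge
-- that can be contracted.
... | w , aw , bw with (case conn w of λ { (inj₁ c) → conn-nonloop c aw ; (inj₂ c) → conn-nonloop c bw })
...   | e , e-mono , ne = step e ne
  (contractible (suc (suc n)) (contract H e ne) (χ ∘ ψ) (φ a) (φ b)
    (λ q → ab (trans (sym (col a)) (trans q (col b))))
    (λ x → case conn (ψ x) of λ
      { (inj₁ c) → inj₁ (subst (Conn _ _ (φ a)) (φψ x) (contract-conn H e ne χ ends-eq c))
      ; (inj₂ c) → inj₂ (subst (Conn _ _ (φ b)) (φψ x) (contract-conn H e ne χ ends-eq c)) })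
    (Data.Nat.Properties.suc-injective (trans (cong (_+ 2) (sym mono-count)) cm))
    (trans (sym nonmono-count) cn))
  where
  φ = merge (src H e) (tgt H e) ne
  ψ = punchIn (tgt H e)
  φψ = merge-punchIn (src H e) (tgt H e) ne
  ends-eq : χ (src H e) ≡ χ (tgt H e)
  ends-eq = eqb⇒≡ e-mono
  col = contract-colour H e ne χ ends-eq
  same : ∀ f → mono H χ (punchIn e f) ≡ mono (contract H e ne) (χ ∘ ψ) f
  same f = cong₂ eqb (sym (col _)) (sym (col _))
  mono-count : count (mono H χ) ≡ suc (count (mono (contract H e ne) (χ ∘ ψ)))
  mono-count = trans (count-punchIn (mono H χ) e) (cong₂ _+_ (cong b2n e-mono) (count-cong same))
  nonmono-count : count (λ f → not (mono H χ f)) ≡ count (λ f → not (mono (contract H e ne) (χ ∘ ψ) f))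
  nonmono-count = trans (count-punchIn (λ f → not (mono H χ f)) e)
    (cong₂ _+_ (cong (b2n ∘ not) e-mono) (count-cong (cong not ∘ same)))

-- The model consists of a spanning forest of the two monochromatic sides rooted at a and b,
-- together with exactly r of the crossing edges.
theta⇒model : ∀ {n m} {G : Graph n m} {P r} → 1 ≤ r → Theta G P r → Σ (Model G r) λ M → ∀ e → P (Model.eemb M e) ≡ true
theta⇒model {n} {m} {G} {P} {r} r≥1 θ
  with grow {G = G} {λ e → P e ∧ mono G (Theta.χ θ) e} {λ x → (Theta.a θ == x) ∨ (Theta.b θ == x)} base
     | subset-of-size (Theta.tok θ) r (Theta.enough θ)
... | S , E , F , closed | T , T⊆ , T-count = M , λ i → EE-P (enum EE i) (enum-∈ EE i)
  where
  open Theta θ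
  EE : Fin m → Bool
  EE e = E e ∨ T e
  EE-P : ∀ e → EE e ≡ true → P e ≡ true
  EE-P e p = case ∨-elim (E e) p of λ
    { (inj₁ q) → proj₁ (∧-elim (P e) (proj₁ (forest-edges F e q))) ; (inj₂ q) → tok⊆ e (T⊆ e q) }
  a∈S : S a ≡ true
  a∈S = roots⊆ F a (∨-introˡ (≡⇒== {x = a} refl))
  b∈S : S b ≡ true
  b∈S = roots⊆ F b (∨-introʳ (a == b) (≡⇒== {x = b} refl))
  reached : ∀ {x y} → Conn G (λ f → P f ∧ mono G χ f) x y → S x ≡ true → S y ≡ true
  reached = conn-ind (λ y → S y ≡ true) closed
  EE-S : ∀ e → EE e ≡ true → inside G S e ≡ true
  EE-S e p = case ∨-elim (E e) p of λ
    { (inj₁ q) → proj₂ (forest-edges F e q)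
    ; (inj₂ q) → case ends e (T⊆ e q) of λ
        { (x , y , j , c , d) → inside-joins S j (reached c a∈S) (reached d b∈S) } }
  E-mono : ∀ e → E e ≡ true → mono G χ e ≡ true
  E-mono e p = proj₂ (∧-elim (P e) (proj₁ (forest-edges F e p)))
  ia : Fin (count S)
  ia = proj₁ (index S a a∈S)
  ib : Fin (count S)
  ib = proj₁ (index S b b∈S)
  s∈ : ∀ i → S (src G (enum EE i)) ≡ true
  s∈ i = proj₁ (∧-elim (S (src G (enum EE i))) (EE-S _ (enum-∈ EE i)))
  t∈ : ∀ i → S (tgt G (enum EE i)) ≡ true
  t∈ i = proj₂ (∧-elim (S (src G (enum EE i))) (EE-S _ (enum-∈ EE i)))
  H : Graph (count S) (count EE)
  H i = proj₁ (index S _ (s∈ i)) , proj₁ (index S _ (t∈ i))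
  compat : ∀ i → G (enum EE i) ≡ (enum S (proj₁ (H i)) , enum S (proj₂ (H i)))
  compat i = sym (cong₂ _,_ (proj₂ (index S _ (s∈ i))) (proj₂ (index S _ (t∈ i))))
  χ′ : Fin (count S) → Bool
  χ′ = χ ∘ enum S
  mono-H : ∀ i → mono H χ′ i ≡ mono G χ (enum EE i)
  mono-H i = sym (cong (λ q → eqb (χ (proj₁ q)) (χ (proj₂ q))) (compat i))
  a≢b : χ a ≢ χ b
  a≢b = theta-sides r≥1 θ
  -- Tokens are not monochromatic, so only forest edges count here; the two roots are distinct
  -- because their colours differ.
  E-count : count (λ e → EE e ∧ mono G χ e) + 2 ≡ count S
  E-count = trans (cong₂ _+_ (count-cong EE-mono) (sym roots-count)) (forest-count F)
    where
    EE-mono : ∀ e → EE e ∧ mono G χ e ≡ E e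
    EE-mono e with bool (E e) | bool (T e)
    ... | inj₁ p | _ = trans (∧-intro (∨-introˡ p) (E-mono e p)) (sym p)
    ... | inj₂ p | inj₁ q = trans (¬true⇒false λ s → tf-absurd (proj₂ (∧-elim (EE e) s)) (cross e (T⊆ e q))) (sym p)
    ... | inj₂ p | inj₂ q = trans (¬true⇒false λ s → case ∨-elim (E e) (proj₁ (∧-elim (EE e) s)) of λ
            { (inj₁ u) → tf-absurd u p ; (inj₂ u) → tf-absurd u q }) (sym p)
    roots-count : count (λ x → (a == x) ∨ (b == x)) ≡ 2
    roots-count = trans (count-insert b (a ==_) (≢⇒== (λ q → a≢b (cong χ q)))) (cong suc (count-singleton a))
  T-cross : count (λ e → EE e ∧ not (mono G χ e)) ≡ r
  T-cross = trans (count-cong EE-cross) T-count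
    where
    EE-cross : ∀ e → EE e ∧ not (mono G χ e) ≡ T e
    EE-cross e with bool (T e)
    ... | inj₁ q = trans (∧-intro (∨-introʳ (E e) q) (not-intro (cross e (T⊆ e q)))) (sym q)
    ... | inj₂ q = trans (¬true⇒false λ s → case ∧-elim (EE e) s of λ
            { (u , v) → case ∨-elim (E e) u of λ
              { (inj₁ w) → tf-absurd (E-mono e w) (not-elim v) ; (inj₂ w) → tf-absurd w q } }) (sym q)
  joins-lift : ∀ f {i x y} → Joins G (enum EE f) x y → enum S i ≡ x → ∃ λ k → enum S k ≡ y × Joins H f i k
  joins-lift f fwd q = _ , proj₂ (index S _ (t∈ f)) ,
    subst (λ z → Joins H f z _) (enum-injective S (trans (proj₂ (index S _ (s∈ f))) (sym q))) fwd
  joins-lift f bwd q = _ , proj₂ (index S _ (s∈ f)) ,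
    subst (λ z → Joins H f z _) (enum-injective S (trans (proj₂ (index S _ (t∈ f))) (sym q))) bwd
  lift-conn : ∀ {x y} → Conn G E x y → ∀ i → enum S i ≡ x → ∃ λ k → enum S k ≡ y × Conn H (mono H χ′) i k
  lift-conn [] i p = i , p , []
  lift-conn (edge e p j c) i refl with index EE e (∨-introˡ p)
  ... | f , refl with joins-lift f j refl
  ...   | k , q , j′ with lift-conn c k q
  ...     | l , s , d = l , s , edge f (trans (mono-H f) (E-mono _ p)) j′ d
  to-root : ∀ w → Conn H (mono H χ′) ia w ⊎ Conn H (mono H χ′) ib w
  to-root w with root-path F (enum S w) (enum-∈ S w)
  ... | ρ , π , ρ∈ , _ , sub , c with lift-conn (conn-⊆ sub c) w refl | ∨-elim (a == ρ) ρ∈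
  ...   | k , q , d | inj₁ s = inj₁ (subst (λ z → Conn H _ z w)
             (enum-injective S (trans q (trans (sym (==⇒≡ a ρ s)) (sym (proj₂ (index S a a∈S)))))) (conn-sym d))
  ...   | k , q , d | inj₂ s = inj₂ (subst (λ z → Conn H _ z w)
             (enum-injective S (trans q (trans (sym (==⇒≡ b ρ s)) (sym (proj₂ (index S b b∈S)))))) (conn-sym d))
  M : Model G r
  M = record
    { H = H ; vemb = enum S ; eemb = enum EE ; vinj = enum-injective S ; einj = enum-injective EE ; compat = compat
    ; contracts = contractible (count S) H χ′ ia ib
        (λ q → a≢b (trans (sym (cong χ (proj₂ (index S a a∈S)))) (trans q (cong χ (proj₂ (index S b b∈S))))))
        to-root
        (trans (cong (_+ 2) (trans (count-cong mono-H) (count-enum EE (mono G χ)))) E-count)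
        (trans (count-cong (cong not ∘ mono-H)) (trans (count-enum EE (not ∘ mono G χ)) T-cross)) }

-- Packing or covering, given that large bonds can be packed

_∖_ : ∀ {n} → (Fin n → Bool) → (Fin n → Bool) → Fin n → Bool
(S ∖ T) x = S x ∧ not (T x)

∖-intro : ∀ {n} (S T : Fin n → Bool) {x} → S x ≡ true → T x ≡ false → (S ∖ T) x ≡ true
∖-intro S T p q = ∧-intro p (not-intro q)

∖-elim : ∀ {n} (S T : Fin n → Bool) {x} → (S ∖ T) x ≡ true → S x ≡ true × T x ≡ false
∖-elim S T {x} p with ∧-elim (S x) p
... | s , t = s , not-elim t

inside-⊆ : ∀ {n m} (G : Graph n m) {S T : Fin n → Bool} → (∀ x → S x ≡ true → T x ≡ true) →
  ∀ e → inside G S e ≡ true → inside G T e ≡ true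
inside-⊆ G {S} h e p with ∧-elim (S (src G e)) p
... | s , t = ∧-intro (h _ s) (h _ t)

conn-under : ∀ {n m} {G : Graph n m} {P P′} (S : Fin n → Bool) →
  (∀ {e x y} → P e ≡ true → Joins G e x y → S x ≡ true → S y ≡ true × P′ e ≡ true) →
  ∀ {x y} → Conn G P x y → S x ≡ true → Conn G P′ x y
conn-under S h []             s = []
conn-under S h (edge e p j c) s with h p j s
... | s′ , p′ = edge e p′ j (conn-under S h c s′)

record Packing {n m} (G : Graph n m) (P : Fin m → Bool) (r k : ℕ) : Set where
  field
    part     : Fin k → Fin m → Bool
    part⊆    : ∀ i e → part i e ≡ true → P e ≡ true
    theta    : ∀ i → Theta G (part i) r
    disjoint : ∀ i j → i ≢ j → ∀ e → part i e ≡ true → part j e ≡ true → ⊥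

empty-packing : ∀ {n m} {G : Graph n m} {P r} → Packing G P r 0
empty-packing = record { part = λ () ; part⊆ = λ () ; theta = λ () ; disjoint = λ () }

packing-⊆ : ∀ {n m} {G : Graph n m} {P P′ r k} → (∀ e → P e ≡ true → P′ e ≡ true) → Packing G P r k → Packing G P′ r k
packing-⊆ h 𝓜 = record { part = part ; part⊆ = λ i e p → h e (part⊆ i e p) ; theta = theta ; disjoint = disjoint }
  where open Packing 𝓜

packing-≤ : ∀ {n m} {G : Graph n m} {P r j k} → j ≤ k → Packing G P r k → Packing G P r j
packing-≤ j≤k 𝓜 = record
  { part = part ∘ ι ; part⊆ = part⊆ ∘ ι ; theta = theta ∘ ι
  ; disjoint = λ i j ne → disjoint (ι i) (ι j) (ne ∘ inject≤-injective j≤k j≤k i j) }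
  where
  open Packing 𝓜
  ι = λ i → inject≤ i j≤k

packing-∷ : ∀ {n m} {G : Graph n m} {P P′ Q r k} →
  (∀ e → P e ≡ true → Q e ≡ true) → (∀ e → P′ e ≡ true → Q e ≡ true) →
  (∀ e → P e ≡ true → P′ e ≡ true → ⊥) →
  Theta G P r → Packing G P′ r k → Packing G Q r (suc k)
packing-∷ {m = m} {G} {P} {P′} {Q} {r} {k} P⊆ P′⊆ apart θ 𝓜 = record
  { part = part′ ; part⊆ = part′⊆ ; theta = theta′ ; disjoint = disjoint′ }
  where
  open Packing 𝓜
  part′ : Fin (suc k) → Fin m → Bool
  part′ zero    = P
  part′ (suc i) = part i
  part′⊆ : ∀ i e → part′ i e ≡ true → Q e ≡ true
  part′⊆ zero    e p = P⊆ e p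
  part′⊆ (suc i) e p = P′⊆ e (part⊆ i e p)
  theta′ : ∀ i → Theta G (part′ i) r
  theta′ zero    = θ
  theta′ (suc i) = theta i
  disjoint′ : ∀ i j → i ≢ j → ∀ e → part′ i e ≡ true → part′ j e ≡ true → ⊥
  disjoint′ zero    zero    ne e p q = ne refl
  disjoint′ zero    (suc j) ne e p q = apart e p (part⊆ j e q)
  disjoint′ (suc i) zero    ne e p q = apart e q (part⊆ i e p)
  disjoint′ (suc i) (suc j) ne e p q = disjoint i j (ne ∘ cong suc) e p q

module _ {n m} {G : Graph n m} {r : ℕ} where

  -- The useful part of a theta is connected: from one end of one token all the walks and tokens are
  -- reached by `P`-edges. A set `W` that these edges cannot leave therefore captures the whole
  -- theta.
  theta-within : ∀ {P P′} (θ : Theta G P r) (W : Fin n → Bool) →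
    (∀ {e x y} → P e ≡ true → Joins G e x y → W x ≡ true → W y ≡ true × P′ e ≡ true) →
    (∃ λ e → Theta.tok θ e ≡ true × W (src G e) ≡ true) → Theta G P′ r
  theta-within {P} {P′} θ W h (e₀ , t₀ , w₀) = record
    { χ = χ ; a = a ; b = b ; tok = tok ; enough = enough ; cross = cross
    ; tok⊆ = λ e t → case ends e t of λ { (x , y , j , c , d) → proj₂ (h (tok⊆ e t) j (along c a∈W)) }
    ; ends = λ e t → case ends e t of λ { (x , y , j , c , d) → x , y , j , conn-under W h′ c a∈W , conn-under W h′ d b∈W } }
    where
    open Theta θ
    h′ : ∀ {e x y} → P e ∧ mono G χ e ≡ true → Joins G e x y → W x ≡ true → W y ≡ true × P′ e ∧ mono G χ e ≡ true
    h′ {e} p j w with ∧-elim (P e) p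
    ... | q , s with h q j w
    ...   | w′ , q′ = w′ , ∧-intro q′ s
    along : ∀ {x y} → Conn G (λ f → P f ∧ mono G χ f) x y → W x ≡ true → W y ≡ true
    along = conn-ind (λ y → W y ≡ true) (λ p j w → proj₁ (h′ p j w))
    a∈W×b∈W : W a ≡ true × W b ≡ true
    a∈W×b∈W with ends e₀ t₀
    ... | x , y , j , c , d with ends⇒joins (λ z → W z ≡ true) j w₀ (proj₁ (h (tok⊆ e₀ t₀) fwd w₀))
    ...   | wx , wy = along (conn-sym c) wx , along (conn-sym d) wy
    a∈W = proj₁ a∈W×b∈W
    b∈W = proj₂ a∈W×b∈W

-- Descent through cut vertices to a minimal pendant set, and the resulting induction

module _ {n m} {G : Graph n m} {r : ℕ} (r≥1 : 1 ≤ r) where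

  -- One step of the descent. By `closed`, the vertex `x` is the only attachment of `D` to the rest
  -- of `K`, and adding it back to `D` restores a theta.
  record Component (K : Fin n → Bool) (x : Fin n) : Set where
    field
      D      : Fin n → Bool
      b      : Fin n
      b∈D    : D b ≡ true
      D⊆K    : ∀ y → D y ≡ true → K y ≡ true
      x∉D    : D x ≡ false
      inner  : ∀ y → D y ≡ true → Conn G (inside G D) b y
      closed : ∀ {e u y} → inside G K e ≡ true → Joins G e u y → D u ≡ true → y ≡ x ⊎ D y ≡ true
      has-theta : Theta G (inside G (insert x D)) r

  -- x is not on the side of b, so that side lies in a single component D of K - x;
  -- the other side is retracted into D + x by sending everything outside D to x.
  opposite-component : ∀ {K} x (θ : Theta G (inside G K) r) → Theta.χ θ (Theta.b θ) ≢ Theta.χ θ x → Component K x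
  opposite-component {K} x θ bx with reach G (inside G (K ∖ (x ==_))) (Theta.b θ)
  ... | D , sound , complete = record
    { D = D ; b = b ; b∈D = complete [] ; D⊆K = λ y p → proj₁ (∖-elim K (x ==_) (D⊆K′ y p))
    ; x∉D = ¬true⇒false λ p → tf-absurd (≡⇒== {x = x} refl) (proj₂ (∖-elim K (x ==_) (D⊆K′ x p)))
    ; inner = λ y p → conn-under D (λ q j w → extend q j w , inside-joins D j w (extend q j w)) (sound y p) (complete [])
    ; closed = closed
    ; has-theta = record
        { χ = χ ; a = φ a ; b = b ; tok = tok ; enough = enough ; cross = cross
        ; tok⊆ = λ e t → case ends e t of λ
            { (u , v , j , c , d) → inside-joins D⁺ j (near t j d) (insert-old x D (proj₁ (b-side d))) }
        ; ends = λ e t → case ends e t of λ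
            { (u , v , j , c , d) → u , v , j ,
                subst (Conn G _ (φ a)) (φ-in (near t j d)) (conn-map φ retract c) , proj₂ (proj₂ (b-side d)) } } }
    where
    open Theta θ
    D⁺ K′ : Fin n → Bool
    D⁺ = insert x D
    K′ = K ∖ (x ==_)
    extend : ∀ {e u v} → inside G K′ e ≡ true → Joins G e u v → D u ≡ true → D v ≡ true
    extend {e} p j q = complete (sound _ q ++ conn-edge e p j)
    b∈K′ : K′ b ≡ true
    b∈K′ with theta-token r≥1 θ
    ... | e , t with ends e t
    ...   | u , v , j , c , d = ∖-intro K (x ==_)
            (conn-ind (λ z → K z ≡ true) (λ {f} p i _ → proj₂ (joins-inside K i (proj₁ (∧-elim (inside G K f) p)))) (conn-sym d)
              (proj₂ (joins-inside K j (tok⊆ e t))))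
            (≢⇒== λ q → bx (cong χ (sym q)))
    D⊆K′ : ∀ y → D y ≡ true → K′ y ≡ true
    D⊆K′ y p = conn-ind (λ z → K′ z ≡ true) (λ q i _ → proj₂ (joins-inside K′ i q)) (sound y p) b∈K′
    closed : ∀ {e u y} → inside G K e ≡ true → Joins G e u y → D u ≡ true → y ≡ x ⊎ D y ≡ true
    closed {y = y} p j q with x ≟ y
    ... | yes s = inj₁ (sym s)
    ... | no ¬s = inj₂ (extend (inside-joins K′ j (D⊆K′ _ q) (∖-intro K (x ==_) (proj₂ (joins-inside K j p)) (≢⇒== ¬s))) j q)
    -- A monochromatic walk from `b` keeps the colour of `b`, hence never meets `x`, which would be
    -- the only way out of `D`.
    b-side : ∀ {u} → Conn G (λ f → inside G K f ∧ mono G χ f) b u →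
      D u ≡ true × χ b ≡ χ u × Conn G (λ f → inside G D⁺ f ∧ mono G χ f) b u
    b-side c = conn-ind (λ u → D u ≡ true × χ b ≡ χ u × Conn G (λ f → inside G D⁺ f ∧ mono G χ f) b u)
        (λ { {f} p j (q , s , d) → go f (proj₁ (∧-elim (inside G K f) p)) (proj₂ (∧-elim (inside G K f) p)) j q s d })
        c (complete [] , refl , [])
      where
      go : ∀ f {u v} → inside G K f ≡ true → mono G χ f ≡ true → Joins G f u v → D u ≡ true → χ b ≡ χ u →
        Conn G (λ f → inside G D⁺ f ∧ mono G χ f) b u → D v ≡ true × χ b ≡ χ v × Conn G (λ f → inside G D⁺ f ∧ mono G χ f) b v
      go f p i j q s d with closed p j q | trans s (joins-mono {χ = χ} j i)
      ... | inj₁ refl | s′ = ⊥-elim (bx s′)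
      ... | inj₂ q′   | s′ = q′ , s′ ,
              d ++ conn-edge f (∧-intro (inside-joins D⁺ j (insert-old x D q) (insert-old x D q′)) i) j
    near : ∀ {e u v} → tok e ≡ true → Joins G e u v → Conn G (λ f → inside G K f ∧ mono G χ f) b v → D⁺ u ≡ true
    near {e} t j d with closed (tok⊆ e t) (joins-sym j) (proj₁ (b-side d))
    ... | inj₁ refl = insert-new x D
    ... | inj₂ q    = insert-old x D q
    φ : Fin n → Fin n
    φ u = if D⁺ u then u else x
    φ-in : ∀ {u} → D⁺ u ≡ true → φ u ≡ u
    φ-in p rewrite p = refl
    φ-out : ∀ {u} → D⁺ u ≡ false → φ u ≡ x
    φ-out p rewrite p = refl
    -- Because `x` is the only exit, an edge from `D⁺` to the outside becomes a trivial walk at `x`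
    -- under `φ`. Thus retracted walks use only original monochromatic edges inside `D⁺`.
    exit : ∀ {e u v} → inside G K e ≡ true → Joins G e u v → D⁺ u ≡ true → D⁺ v ≡ false → u ≡ x
    exit p j q q′ with insert-elim x D q
    ... | inj₂ s = sym s
    ... | inj₁ s with closed p j s
    ...   | inj₁ refl = tf-absurd (insert-new x D) q′
    ...   | inj₂ z    = tf-absurd (insert-old x D z) q′
    retract : ∀ {e u v} → inside G K e ∧ mono G χ e ≡ true → Joins G e u v →
      Conn G (λ f → inside G D⁺ f ∧ mono G χ f) (φ u) (φ v)
    retract {e} {u} {v} p j with ∧-elim (inside G K e) p | bool (D⁺ u) | bool (D⁺ v)
    ... | i , c | inj₁ q | inj₁ q′ = subst₂ (Conn G _) (sym (φ-in q)) (sym (φ-in q′)) (conn-edge e (∧-intro (inside-joins D⁺ j q q′) c) j)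
    ... | i , c | inj₁ q | inj₂ q′ = subst₂ (Conn G _) (trans (sym (exit i j q q′)) (sym (φ-in q))) (sym (φ-out q′)) []
    ... | i , c | inj₂ q | inj₁ q′ = subst₂ (Conn G _) (sym (φ-out q)) (trans (sym (exit i (joins-sym j) q′ q)) (sym (φ-in q′))) []
    ... | i , c | inj₂ q | inj₂ q′ = subst₂ (Conn G _) (sym (φ-out q)) (sym (φ-out q′)) []

  -- The representatives `a` and `b` have different colours, so at least one of them differs in
  -- colour from `x`.
  component : ∀ {K} x → Theta G (inside G K) r → Component K x
  component x θ with bool (eqb (Theta.χ θ (Theta.b θ)) (Theta.χ θ x))
  ... | inj₂ p = opposite-component x θ λ q → tf-absurd (≡⇒eqb q) p
  ... | inj₁ p = opposite-component x (theta-swap θ) λ q → theta-sides r≥1 θ (trans q (sym (eqb⇒≡ p)))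

  -- By outer and adj, deleting D leaves the rest of its component of U connected, so its boundary is a bond.
  record Pendant (U : Fin n → Bool) : Set where
    field
      D     : Fin n → Bool
      t a   : Fin n
      D⊆U   : ∀ y → D y ≡ true → U y ≡ true
      t∈U   : U t ≡ true
      t∉D   : D t ≡ false
      a∈D   : D a ≡ true
      inner : ∀ y → D y ≡ true → Conn G (inside G D) a y
      outer : ∀ {y} → Conn G (inside G U) t y → D y ≡ false → Conn G (inside G (U ∖ D)) t y
      adj   : ∃ λ e → ∃ λ z → D z ≡ true × Joins G e z t
      has-theta : Theta G (inside G (insert t D)) r

  -- A walk that enters `D` can return only through `x`, where it may as well start afresh; all
  -- excursions into `D` are cut out in this way.
  component-outer : ∀ {U K x} → (∀ y → K y ≡ true → U y ≡ true) → (C : Component K x) → ∀ {y} → Conn G (inside G K) x y →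
    Component.D C y ≡ true ⊎ Conn G (inside G (U ∖ Component.D C)) x y
  component-outer {U} {K} {x} K⊆U C c = conn-ind (λ y → D y ≡ true ⊎ Conn G (inside G (U ∖ D)) x y) go c (inj₂ [])
    where
    open Component C
    go : ∀ {e u y} → inside G K e ≡ true → Joins G e u y → D u ≡ true ⊎ Conn G (inside G (U ∖ D)) x u →
      D y ≡ true ⊎ Conn G (inside G (U ∖ D)) x y
    go {e} {u} {y} p j z with bool (D y) | bool (D u) | z
    ... | inj₁ q | _ | _ = inj₁ q
    ... | inj₂ q | inj₁ q′ | _ with closed p j q′
    ...   | inj₁ refl = inj₂ []
    ...   | inj₂ s    = inj₁ s
    go {e} {u} {y} p j z | inj₂ q | inj₂ q′ | inj₁ s = tf-absurd s q′
    go {e} {u} {y} p j z | inj₂ q | inj₂ q′ | inj₂ d with joins-inside K j p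
    ... | ku , ky = inj₂ (d ++ conn-edge e (inside-joins (U ∖ D) j (∖-intro U D (K⊆U u ku) q′) (∖-intro U D (K⊆U y ky) q)) j)

  -- A walk from `b` to `x` has to leave `D`, and the first edge doing so ends at `x`.
  component-adj : ∀ {K x} (C : Component K x) → Conn G (inside G K) (Component.b C) x →
    ∃ λ e → ∃ λ z → Component.D C z ≡ true × Joins G e z x
  component-adj {K} {x} C c with conn-ind (λ u → D u ≡ true ⊎ ∃ λ e → ∃ λ z → D z ≡ true × Joins G e z x) go c (inj₁ b∈D)
    where
    open Component C
    go : ∀ {e u y} → inside G K e ≡ true → Joins G e u y → (D u ≡ true ⊎ ∃ λ e → ∃ λ z → D z ≡ true × Joins G e z x) →
      D y ≡ true ⊎ ∃ λ e → ∃ λ z → D z ≡ true × Joins G e z x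
    go p j (inj₂ A) = inj₂ A
    go {e} {u} p j (inj₁ q) with closed p j q
    ... | inj₁ refl = inj₂ (e , u , q , j)
    ... | inj₂ s    = inj₁ s
  ... | inj₁ q = tf-absurd q (Component.x∉D C)
  ... | inj₂ A = A

  -- The attachment `t` is the end of a token on the side of `a`. The side of `b` then avoids it,
  -- and the token itself shows that `t` is joined to that side.
  pendant : ∀ {U} → Theta G (inside G U) r → Pendant U
  pendant {U} θ with theta-token r≥1 θ
  ... | e , t with Theta.ends θ e t
  ...   | x , y , j , c , d = record
    { D = D ; t = x ; a = b ; D⊆U = D⊆K ; t∈U = proj₁ (joins-inside U j (Theta.tok⊆ θ e t)) ; t∉D = x∉D ; a∈D = b∈D
    ; inner = inner ; has-theta = θD
    ; outer = λ z q → case component-outer (λ _ s → s) C z of λ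
        { (inj₁ s) → tf-absurd s q ; (inj₂ s) → s }
    ; adj = component-adj C (conn-⊆ (λ f p → proj₁ (∧-elim (inside G U f) p)) d ++ conn-edge e (Theta.tok⊆ θ e t) (joins-sym j)) }
    where
    x-side : Theta.χ θ (Theta.a θ) ≡ Theta.χ θ x
    x-side = conn-mono (λ f p → proj₂ (∧-elim (inside G U f) p)) c
    C = opposite-component x θ (λ q → theta-sides r≥1 θ (trans x-side (sym q)))
    open Component C renaming (has-theta to θD)

  -- The next attachment is a neighbour `x` of `t` inside `D`, which makes the new set strictly
  -- smaller. The remainder stays connected: vertices of the old `D` are reached from `x` inside
  -- `D`, and those outside by crossing to `t` and then using the old `outer`.
  pendant-step : ∀ {U} (D : Pendant U) → Theta G (inside G (Pendant.D D)) r →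
    Σ (Pendant U) λ D′ → count (Pendant.D D′) < count (Pendant.D D)
  pendant-step {U} 𝓓 θD with Pendant.adj 𝓓
  ... | e , x , x∈D , j = record
    { D = D′ ; t = x ; a = b ; D⊆U = λ y p → D⊆U y (D⊆K y p) ; t∈U = D⊆U x x∈D ; t∉D = x∉D ; a∈D = b∈D
    ; inner = inner′ ; has-theta = θ′ ; outer = outer′
    ; adj = component-adj C (conn-sym (inner b (D⊆K b b∈D)) ++ inner x x∈D) } ,
    count-strict D⊆K x x∉D x∈D
    where
    open Pendant 𝓓
    C = component x θD
    open Component C renaming (D to D′; has-theta to θ′; inner to inner′)
    xt : inside G U e ≡ true
    xt = inside-joins U j (D⊆U x x∈D) t∈U
    t∉D′ : D′ t ≡ false
    t∉D′ = ¬true⇒false λ p → tf-absurd (D⊆K t p) t∉D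
    outer′ : ∀ {y} → Conn G (inside G U) x y → D′ y ≡ false → Conn G (inside G (U ∖ D′)) x y
    outer′ {y} c q with bool (D y)
    ... | inj₁ p = case component-outer D⊆U C (conn-sym (inner x x∈D) ++ inner y p) of λ
            { (inj₁ s) → tf-absurd s q ; (inj₂ s) → s }
    ... | inj₂ p = edge e (inside-joins (U ∖ D′) j (∖-intro U D′ (D⊆U x x∈D) x∉D) (∖-intro U D′ t∈U t∉D′)) j
            (conn-⊆ (inside-⊆ G λ z s → case ∖-elim U D s of λ
                { (u , w) → ∖-intro U D′ u (¬true⇒false λ v → tf-absurd (D⊆K z v) w) })
              (outer (edge e xt (joins-sym j) c) p))

  minimal-pendant : ∀ {U} → Theta G (inside G U) r → Σ (Pendant U) λ D → ¬ Theta G (inside G (Pendant.D D)) r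
  minimal-pendant {U} θ = go (count (Pendant.D (pendant {U} θ))) (pendant {U} θ) ≤-refl
    where
    go : ∀ k (D : Pendant U) → count (Pendant.D D) ≤ k → Σ (Pendant U) λ D → ¬ Theta G (inside G (Pendant.D D)) r
    go k D h with theta? G (inside G (Pendant.D D)) r
    ... | no ¬θ = D , ¬θ
    ... | yes θD with pendant-step D θD
    go zero D h | yes θD | D′ , lt = ⊥-elim (n≮0 (<-≤-trans lt h))
    go (suc k) D h | yes θD | D′ , lt = go k D′ (≤-pred (<-≤-trans lt h))

  boundary : (U D : Fin n → Bool) → Fin m → Bool
  boundary U D e = inside G U e ∧ not (mono G D e)

  -- All boundary edges serve as tokens. An outer end is reachable from `t` in `U` through `D`, and
  -- then by `outer` also without `D`.
  pendant-bond : ∀ {U} (D : Pendant U) → Theta G (inside G U) (count (boundary U (Pendant.D D)))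
  pendant-bond {U} 𝓓 = record
    { χ = D ; a = a ; b = t ; tok = boundary U D ; tok⊆ = λ e p → proj₁ (∧-elim (inside G U e) p) ; enough = ≤-refl
    ; cross = λ e p → not-elim (proj₂ (∧-elim (inside G U e) p))
    ; ends = ends }
    where
    open Pendant 𝓓
    inD : ∀ e → inside G D e ≡ true → inside G U e ∧ mono G D e ≡ true
    inD e p with ∧-elim (D (src G e)) p
    ... | s , s′ = ∧-intro (∧-intro (D⊆U _ s) (D⊆U _ s′)) (≡⇒eqb (trans s (sym s′)))
    outD : ∀ e → inside G (U ∖ D) e ≡ true → inside G U e ∧ mono G D e ≡ true
    outD e p with ∧-elim ((U ∖ D) (src G e)) p
    ... | s , s′ with ∖-elim U D s | ∖-elim U D s′
    ...   | u , w | u′ , w′ = ∧-intro (∧-intro u u′) (≡⇒eqb (trans w (sym w′)))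
    t-a : Conn G (inside G U) t a
    t-a with adj
    ... | e , z , z∈D , j = edge e (inside-joins U j (D⊆U z z∈D) t∈U) (joins-sym j) (conn-sym (conn-⊆ (inside-⊆ G D⊆U) (inner z z∈D)))
    across : ∀ {e z y} → inside G U e ≡ true → Joins G e z y → D z ≡ true → D y ≡ false →
      Conn G (λ f → inside G U f ∧ mono G D f) a z × Conn G (λ f → inside G U f ∧ mono G D f) t y
    across {e} {z} i j p q = conn-⊆ inD (inner z p) ,
      conn-⊆ outD (outer (t-a ++ (conn-⊆ (inside-⊆ G D⊆U) (inner z p) ++ conn-edge e i j)) q)
    ends : ∀ e → boundary U D e ≡ true → ∃ λ x → ∃ λ y → Joins G e x y ×
      Conn G (λ f → inside G U f ∧ mono G D f) a x × Conn G (λ f → inside G U f ∧ mono G D f) t y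
    ends e p with ∧-elim (inside G U e) p | bool (D (src G e)) | bool (D (tgt G e))
    ... | i , ne | inj₁ s | inj₁ s′ = tf-absurd (≡⇒eqb (trans s (sym s′))) (not-elim ne)
    ... | i , ne | inj₂ s | inj₂ s′ = tf-absurd (≡⇒eqb (trans s (sym s′))) (not-elim ne)
    ... | i , ne | inj₁ s | inj₂ s′ = _ , _ , fwd , across i fwd s s′
    ... | i , ne | inj₂ s | inj₁ s′ = _ , _ , bwd , across i bwd s′ s

  -- The target `j` decreases while `k` and the threshold `B` stay fixed: a large bond met at any
  -- stage yields all `k` thetas, of which `j` are kept. Each other stage adds at most `B` edges to
  -- the cover.
  pack-or-cover : Loopless G → ∀ {B k} → (∀ P → Theta G P B → Packing G P r k) → ∀ j → j ≤ k → ∀ U →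
    Packing G (inside G U) r j ⊎
    Σ (Fin m → Bool) λ X → count X ≤ j * B × ¬ Theta G (λ e → inside G U e ∧ not (X e)) r
  pack-or-cover loopless bond zero j≤k U = inj₁ empty-packing
  pack-or-cover loopless {B} {k} bond (suc j) j≤k U with theta? G (inside G U) r
  ... | no ¬θ = inj₂ ((λ _ → false) , ≤-trans (≤-reflexive (count-empty {m})) z≤n ,
                      ¬θ ∘ theta-⊆ (λ e p → proj₁ (∧-elim (inside G U e) p)))
  ... | yes θ with minimal-pendant θ
  ...   | 𝓓 , ¬θD with ≤-total B (count (boundary U (Pendant.D 𝓓)))
  ...     | inj₁ h = inj₁ (packing-≤ j≤k (bond (inside G U) (record { Theta (pendant-bond 𝓓) ; enough = h })))
  ...     | inj₂ h with pack-or-cover loopless bond j (≤-trans (n≤1+n j) j≤k) (U ∖ Pendant.D 𝓓)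
  ...       | inj₁ 𝓜 = inj₁ (packing-∷ (inside-⊆ G in-U) (inside-⊆ G {U ∖ D} λ x p → proj₁ (∖-elim U D p)) apart θ′ 𝓜)
    where
    open Pendant 𝓓 renaming (has-theta to θ′)
    in-U : ∀ x → insert t D x ≡ true → U x ≡ true
    in-U x p with insert-elim t D p
    ... | inj₁ q = D⊆U x q
    ... | inj₂ refl = t∈U
    only-t : ∀ {x} → insert t D x ≡ true → (U ∖ D) x ≡ true → t ≡ x
    only-t p q with insert-elim t D p
    ... | inj₁ s = tf-absurd s (proj₂ (∖-elim U D q))
    ... | inj₂ s = s
    -- The two vertex sets share only `t`, so a common edge would be a loop at `t`.
    apart : ∀ e → inside G (insert t D) e ≡ true → inside G (U ∖ D) e ≡ true → ⊥
    apart e p q with ∧-elim (insert t D (src G e)) p | ∧-elim ((U ∖ D) (src G e)) q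
    ... | s , s′ | u , u′ = loopless e (trans (sym (only-t s u)) (only-t s′ u′))
  ...       | inj₂ (X , X-count , ¬θX) = inj₂ (Y ,
      ≤-trans (count-∨ (boundary U D) X) (+-mono-≤ h X-count) , uncovered)
    where
    open Pendant 𝓓 renaming (has-theta to θ′)
    Y : Fin m → Bool
    Y e = boundary U D e ∨ X e
    P : Fin m → Bool
    P e = inside G U e ∧ not (Y e)
    P-elim : ∀ e → P e ≡ true → inside G U e ≡ true × mono G D e ≡ true × X e ≡ false
    P-elim e p with ∧-elim (inside G U e) p
    ... | i , ny with ∨-false (boundary U D e) (not-elim ny)
    ...   | nb , nx with bool (mono G D e)
    ...     | inj₁ s = i , s , nx
    ...     | inj₂ s = tf-absurd (∧-intro i (not-intro s)) nb
    uncovered : ¬ Theta G P r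
    -- No remaining edge crosses the boundary of `D`, so the position of one token decides on which
    -- side the whole theta lies. Inside `D` it contradicts minimality, outside it contradicts the
    -- induction hypothesis.
    uncovered η with theta-token r≥1 η
    ... | e , τ with bool (D (src G e))
    ...   | inj₁ s = ¬θD (theta-within η D
              (λ { {f} p j w → case P-elim f p of λ { (i , c , nx) →
                let w′ = trans (sym (joins-mono {χ = D} j c)) w in w′ , inside-joins D j w w′ } }) (e , τ , s))
    ...   | inj₂ s = ¬θX (theta-within η (not ∘ D)
              (λ { {f} p j w → case P-elim f p of λ { (i , c , nx) →
                let w′ = trans (sym (joins-mono {χ = D} j c)) (not-elim w) in not-intro w′ ,
                  ∧-intro (inside-joins (U ∖ D) j (∖-intro U D (proj₁ (joins-inside U j i)) (not-elim w))
                                                  (∖-intro U D (proj₂ (joins-inside U j i)) w′)) (not-intro nx) } })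
              (e , τ , not-intro s))

-- Merging trees into hubs

-- Vertex y has been merged into loc y, along the edges of path y.
record Clustering {n m} (G : Graph n m) (P : Fin m → Bool) (S : Fin n → Bool) : Set where
  field
    loc   : Fin n → Fin n
    path  : Fin n → Fin m → Bool
    fixed : ∀ u → S u ≡ true → loc u ≡ u
    conn  : ∀ y → Conn G (path y) y (loc y)
    local : ∀ y e → path y e ≡ true → loc (src G e) ≡ loc y × loc (tgt G e) ≡ loc y
    path⊆ : ∀ y e → path y e ≡ true → P e ≡ true

module _ {n m} {G : Graph n m} {P : Fin m → Bool} where

  trivial : ∀ {S} → Clustering G P S
  trivial = record { loc = id ; path = λ _ _ → false ; fixed = λ _ _ → refl ; conn = λ _ → [] ; local = λ _ _ () ; path⊆ = λ _ _ () }

  -- Retires `v` as a hub: the clusters stay as they are, and only the set of vertices still to be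
  -- processed shrinks.
  forget : ∀ {S} v → Clustering G P (insert v S) → Clustering G P S
  forget {S} v 𝓒 = record { loc = loc ; path = path ; fixed = λ u p → fixed u (insert-old v S p) ; conn = conn ; local = local ; path⊆ = path⊆ }
    where open Clustering 𝓒

  module Absorb {S : Fin n → Bool} {p v e} (p∈S : S p ≡ true) (v∉S : S v ≡ false) (e∈P : P e ≡ true) (j : Joins G e p v)
                (𝓒 : Clustering G P (insert v S)) where
    open Clustering 𝓒

    redirect : Fin n → Fin n
    redirect z = if v == z then p else z

    redirect-≡ : ∀ {z} → v ≡ z → redirect z ≡ p
    redirect-≡ q rewrite ≡⇒== q = refl

    redirect-≢ : ∀ {z} → v ≢ z → redirect z ≡ z
    redirect-≢ q rewrite ≢⇒== q = refl

    path′ : Fin n → Fin m → Bool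
    path′ y f = path y f ∨ ((v == loc y) ∧ (e == f))

    path′-elim : ∀ y f → path′ y f ≡ true → path y f ≡ true ⊎ (v ≡ loc y × e ≡ f)
    path′-elim y f q with ∨-elim (path y f) q
    ... | inj₁ s = inj₁ s
    ... | inj₂ s with ∧-elim (v == loc y) s
    ...   | t , u = inj₂ (==⇒≡ _ _ t , ==⇒≡ _ _ u)

    v≢S : ∀ {u} → S u ≡ true → v ≢ u
    v≢S s refl = tf-absurd s v∉S

    loc-v : loc v ≡ v
    loc-v = fixed v (insert-new v S)

    loc-p : loc p ≡ p
    loc-p = fixed p (insert-old v S p∈S)

    -- Edges of a path stay within one cluster, but `p` and `v` are both still unmerged and hence
    -- lie in different clusters.
    fresh : ∀ y → path y e ≡ true → ⊥
    fresh y q with local y e q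
    ... | s , t with ends⇒joins (λ z → loc z ≡ loc y) j s t
    ...   | lp , lv = v≢S p∈S (trans (sym loc-v) (trans lv (trans (sym lp) loc-p)))

    -- Everything located at `v` moves to `p`, and all these paths are extended by the same edge
    -- `e`; other paths do not change.
    absorb : Clustering G P S
    absorb = record
      { loc = redirect ∘ loc ; path = path′
      ; fixed = λ u s → trans (cong redirect (fixed u (insert-old v S s))) (redirect-≢ (v≢S s))
      ; conn = conn′ ; local = local′
      ; path⊆ = λ y f q → case path′-elim y f q of λ { (inj₁ s) → path⊆ y f s ; (inj₂ (_ , refl)) → e∈P } }
      where
      conn′ : ∀ y → Conn G (path′ y) y (redirect (loc y))
      conn′ y with v ≟ loc y
      ... | yes q = conn-⊆ (λ f → ∨-introˡ) (conn y) ++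
              subst (λ z → Conn G (path′-yes) z p) q (conn-edge e (∨-introʳ (path y e) (≡⇒== {x = e} refl)) (joins-sym j))
        where path′-yes = λ f → path y f ∨ (true ∧ (e == f))
      ... | no _ = conn-⊆ (λ f → ∨-introˡ) (conn y)
      local′ : ∀ y f → path′ y f ≡ true → redirect (loc (src G f)) ≡ redirect (loc y) × redirect (loc (tgt G f)) ≡ redirect (loc y)
      local′ y f q with path′-elim y f q
      ... | inj₁ s with local y f s
      ...   | a , b = cong redirect a , cong redirect b
      local′ y f q | inj₂ (s , refl) = joins⇒ends (λ z → redirect (loc z) ≡ redirect (loc y)) j
        (trans (trans (cong redirect loc-p) (redirect-≢ (v≢S p∈S))) (sym (redirect-≡ s)))
        (trans (cong redirect loc-v) (cong redirect s))

  meets : ∀ {S} → Clustering G P S → Fin n → Fin n → Bool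
  meets 𝓒 y z = any (λ e → path y e ∧ path z e)
    where open Clustering 𝓒

  meets-intro : ∀ {S} (𝓒 : Clustering G P S) y z e → Clustering.path 𝓒 y e ≡ true → Clustering.path 𝓒 z e ≡ true → meets 𝓒 y z ≡ true
  meets-intro 𝓒 y z e q s = any-intro (λ e → Clustering.path 𝓒 y e ∧ Clustering.path 𝓒 z e) e (∧-intro q s)

  meets-elim : ∀ {S} (𝓒 : Clustering G P S) y z → meets 𝓒 y z ≡ true → ∃ λ e → Clustering.path 𝓒 y e ≡ true × Clustering.path 𝓒 z e ≡ true
  meets-elim 𝓒 y z q with any-elim _ q
  ... | e , s with ∧-elim (Clustering.path 𝓒 y e) s
  ...   | a , b = e , a , b

  -- The edges of `T` that become unusable once a theta runs along the path of `y`.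
  clash : ∀ {S} → (Fin m → Bool) → Clustering G P S → Fin n → Fin m → Bool
  clash T 𝓒 y τ = T τ ∧ (meets 𝓒 y (src G τ) ∨ meets 𝓒 y (tgt G τ))

module _ {n m} (G : Graph n m) (P T : Fin m → Bool) (c : ℕ) (S₀ : Fin n → Bool) where

  -- A leaf holding at least c ends of edges of T becomes a hub; otherwise it is merged into its parent, and then
  -- at most c edges of T can run through it. Hence a path shares edges with the paths of at most c edges of T.
  record Hubs (S : Fin n → Bool) : Set where
    field
      clustering : Clustering G P S
    open Clustering clustering public
    field
      hub     : Fin n → Bool
      hub∉    : ∀ u → S u ≡ true → hub u ≡ false
      light   : ∀ y → count (clash T clustering y) ≤ c
      heavy   : c * count hub ≤ count (λ τ → T τ ∧ hub (loc (src G τ))) + count (λ τ → T τ ∧ hub (loc (tgt G τ)))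
      covered : ∀ y → S₀ y ≡ true → S (loc y) ≡ true ⊎ hub (loc y) ≡ true

  no-hubs : Hubs S₀
  no-hubs = record
    { clustering = trivial ; hub = λ _ → false ; hub∉ = λ _ _ → refl
    ; light = λ y → ≤-trans (count-mono {g = λ _ → false} λ τ p → case ∨-elim (meets (trivial {G = G} {P} {S₀}) y (src G τ)) (proj₂ (∧-elim (T τ) p)) of λ
        { (inj₁ q) → case meets-elim (trivial {G = G} {P} {S₀}) y (src G τ) q of λ () ; (inj₂ q) → case meets-elim (trivial {G = G} {P} {S₀}) y (tgt G τ) q of λ () })
        (≤-trans (≤-reflexive (count-empty {m})) z≤n)
    ; heavy = ≤-trans (≤-reflexive (trans (cong (c *_) (count-empty {n})) (*-zeroʳ c))) z≤n
    ; covered = λ y p → inj₁ p }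

  module _ {S : Fin n → Bool} {p v e} (p∈S : S p ≡ true) (v∉S : S v ≡ false) (e∈P : P e ≡ true) (j : Joins G e p v)
           (𝓗 : Hubs (insert v S)) where
    open Hubs 𝓗

    private
      at-v : Fin m → Bool
      at-v τ = T τ ∧ ((v == loc (src G τ)) ∨ (v == loc (tgt G τ)))

      v∉hub : hub v ≡ false
      v∉hub = hub∉ v (insert-new v S)

    -- Ends are counted, not edges, since an edge may have ends at two hubs. The ends at `v` are
    -- disjoint from those charged to older hubs, so the new hub pays for itself. No path is
    -- extended, hence `light` persists however many edges end at `v`.
    make-hub : c ≤ count at-v → Hubs S
    make-hub h = record
      { clustering = forget v clustering ; hub = insert v hub ; light = light
      ; hub∉ = λ u s → ¬true⇒false λ q → case insert-elim v hub q of λ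
          { (inj₁ t) → tf-absurd t (hub∉ u (insert-old v S s)) ; (inj₂ refl) → tf-absurd s v∉S }
      ; heavy = begin
          c * count (insert v hub)                    ≡⟨ cong (c *_) (count-insert v hub v∉hub) ⟩
          c * suc (count hub)                         ≡⟨ *-suc c (count hub) ⟩
          c + c * count hub                           ≤⟨ +-mono-≤ h heavy ⟩
          count at-v + (count (old (src G)) + count (old (tgt G)))
            ≤⟨ +-monoˡ-≤ _ (≤-trans (count-mono {g = λ τ → new (src G) τ ∨ new (tgt G) τ} split) (count-∨ (new (src G)) (new (tgt G)))) ⟩
          (count (new (src G)) + count (new (tgt G))) + (count (old (src G)) + count (old (tgt G)))
            ≡⟨ interchange (count (new (src G))) _ _ _ ⟩
          (count (new (src G)) + count (old (src G))) + (count (new (tgt G)) + count (old (tgt G)))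
            ≤⟨ +-mono-≤ (both (src G)) (both (tgt G)) ⟩
          _ ∎
      ; covered = λ y s → case covered y s of λ
          { (inj₂ q) → inj₂ (insert-old v hub q)
          ; (inj₁ q) → case insert-elim v S q of λ
              { (inj₁ t) → inj₁ t ; (inj₂ t) → inj₂ (subst (λ z → insert v hub z ≡ true) t (insert-new v hub)) } } }
      where
      open ≤-Reasoning
      new old : (Fin m → Fin n) → Fin m → Bool
      new end τ = T τ ∧ (v == loc (end τ))
      old end τ = T τ ∧ hub (loc (end τ))
      split : ∀ τ → at-v τ ≡ true → new (src G) τ ∨ new (tgt G) τ ≡ true
      split τ q with ∧-elim (T τ) q
      ... | t , s with ∨-elim (v == loc (src G τ)) s
      ...   | inj₁ u = ∨-introˡ (∧-intro t u)
      ...   | inj₂ u = ∨-introʳ (new (src G) τ) (∧-intro t u)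
      both : ∀ end → count (new end) + count (old end) ≤ count (λ τ → T τ ∧ insert v hub (loc (end τ)))
      both end = count-disjoint-≤ (new end) (old end) _
        (λ τ q → case ∧-elim (T τ) q of λ { (t , s) → ∧-intro t (∨-introʳ (hub (loc (end τ))) s) })
        (λ τ q → case ∧-elim (T τ) q of λ { (t , s) → ∧-intro t (∨-introˡ s) })
        (λ τ q → ¬true⇒false λ s → tf-absurd (proj₂ (∧-elim (T τ) s))
          (subst (λ z → hub z ≡ false) (==⇒≡ v _ (proj₂ (∧-elim (T τ) q))) v∉hub))

    open Absorb p∈S v∉S e∈P j clustering

    -- The new edge `e` is used exactly by the paths of vertices located at `v`, and paths share
    -- edges only within a cluster. So these paths clash only with edges of `T` ending at `v`, of
    -- which there are at most `c`; for the other paths no clash is added.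
    absorb-leaf : count at-v ≤ c → Hubs S
    absorb-leaf h = record
      { clustering = absorb ; hub = hub ; hub∉ = λ u s → hub∉ u (insert-old v S s)
      ; light = light′
      ; heavy = ≤-trans heavy (+-mono-≤ (count-mono (kept (src G))) (count-mono (kept (tgt G))))
      ; covered = covered′ }
      where
      stays : ∀ {z} → hub z ≡ true → redirect z ≡ z
      stays q = redirect-≢ λ { refl → tf-absurd q v∉hub }
      kept : ∀ end τ → T τ ∧ hub (loc (end τ)) ≡ true → T τ ∧ hub (redirect (loc (end τ))) ≡ true
      kept end τ q with ∧-elim (T τ) q
      ... | t , s = ∧-intro t (trans (cong hub (stays s)) s)
      covered′ : ∀ y → S₀ y ≡ true → S (redirect (loc y)) ≡ true ⊎ hub (redirect (loc y)) ≡ true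
      covered′ y s with covered y s
      ... | inj₂ q = inj₂ (trans (cong hub (stays q)) q)
      ... | inj₁ q with insert-elim v S q
      ...   | inj₁ t = inj₁ (trans (cong S (redirect-≢ (v≢S t))) t)
      ...   | inj₂ t = inj₁ (trans (cong S (redirect-≡ t)) p∈S)
      meets-v : ∀ y z → v ≡ loc y → meets absorb y z ≡ true → v ≡ loc z
      meets-v y z q s with meets-elim absorb y z s
      ... | f , a , b with path′-elim y f a | path′-elim z f b
      ...   | _ | inj₂ (t , _) = t
      ...   | inj₂ (_ , refl) | inj₁ b′ = ⊥-elim (fresh z b′)
      ...   | inj₁ a′ | inj₁ b′ = trans q (trans (sym (proj₁ (local y f a′))) (proj₁ (local z f b′)))
      meets-old : ∀ y z → v ≢ loc y → meets absorb y z ≡ true → meets clustering y z ≡ true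
      meets-old y z q s with meets-elim absorb y z s
      ... | f , a , b with path′-elim y f a | path′-elim z f b
      ...   | inj₂ (t , _) | _ = ⊥-elim (q t)
      ...   | inj₁ a′ | inj₂ (_ , refl) = ⊥-elim (fresh y a′)
      ...   | inj₁ a′ | inj₁ b′ = meets-intro clustering y z f a′ b′
      light′ : ∀ y → count (clash T absorb y) ≤ c
      light′ y = case v ≟ loc y of λ
        { (yes q) → ≤-trans (count-mono λ τ s → case ∧-elim (T τ) s of λ
              { (t , u) → ∧-intro t (case ∨-elim (meets absorb y (src G τ)) u of λ
                { (inj₁ w) → ∨-introˡ (≡⇒== (meets-v y _ q w)) ; (inj₂ w) → ∨-introʳ (v == loc (src G τ)) (≡⇒== (meets-v y _ q w)) }) }) h
        ; (no q) → ≤-trans (count-mono λ τ s → case ∧-elim (T τ) s of λ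
              { (t , u) → ∧-intro t (case ∨-elim (meets absorb y (src G τ)) u of λ
                { (inj₁ w) → ∨-introˡ (meets-old y _ q w) ; (inj₂ w) → ∨-introʳ (meets clustering y (src G τ)) (meets-old y _ q w) }) }) (light y) }

    process-leaf : Hubs S
    process-leaf with ≤-total c (count at-v)
    ... | inj₁ h = make-hub h
    ... | inj₂ h = absorb-leaf h

  -- Leaves are processed in reverse order of insertion, so the descendants of `v` have been handled
  -- before `v`. In the end every vertex of `S₀` sits at a root or a hub.
  peel : ∀ {R S E} → Forest G P R S E → Hubs S → Hubs R
  peel base 𝓗 = 𝓗
  peel (leaf F p v e p∈S v∉S e∈P j) 𝓗 = peel F (process-leaf p∈S v∉S e∈P j 𝓗)

-- Small thetas in dense multigraphs

module _ {n m} {G : Graph n m} {P : Fin m → Bool} {R : Fin n → Bool} where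

  depth-new : ∀ {S E} (F : Forest G P R S E) {p v e} (sp : S p ≡ true) (sv : S v ≡ false) (pe : P e ≡ true) (j : Joins G e p v) →
    ∀ {x} → v ≡ x → depth (leaf F p v e sp sv pe j) x ≡ suc (depth F p)
  depth-new F sp sv pe j q rewrite ≡⇒== q = refl

  depth-old : ∀ {S E} (F : Forest G P R S E) {p v e} (sp : S p ≡ true) (sv : S v ≡ false) (pe : P e ≡ true) (j : Joins G e p v) →
    ∀ {x} → v ≢ x → depth (leaf F p v e sp sv pe j) x ≡ depth F x
  depth-old F sp sv pe j q rewrite ≢⇒== q = refl

module _ {n m} (Q : Graph n m) where

  touching induced : (A : Fin m → Bool) (S : Fin n → Bool) → Fin m → Bool
  touching A S e = A e ∧ (S (src Q e) ∨ S (tgt Q e))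
  induced  A S e = A e ∧ inside Q S e

  -- Only a bound on the depth is required; the set need not contain every vertex within distance
  -- `d`.
  record Ball (A : Fin m → Bool) (ρ : Fin n) (d : ℕ) (S : Fin n → Bool) : Set where
    field
      edges   : Fin m → Bool
      forest  : Forest Q A (ρ ==_) S edges
      shallow : ∀ x → S x ≡ true → depth forest x ≤ d

  module _ {A : Fin m → Bool} {ρ : Fin n} where

    -- New leaves are attached to vertices of the original `S` only, never to each other, which
    -- keeps the depth at most d + 1. When no more can be attached, every edge that touched `S` lies
    -- inside the new set.
    expand : ∀ {d S} → Ball A ρ d S → ∃ λ S′ → Ball A ρ (suc d) S′ × count (touching A S) ≤ count (induced A S′)
    expand {d} {S} 𝓑 = next n (Ball.forest 𝓑) (λ _ s → s) (Ball.shallow 𝓑) (λ x s → m≤n⇒m≤1+n (Ball.shallow 𝓑 x s)) (m≤n+m n (count S))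
      where
      Result : Set
      Result = ∃ λ S′ → Ball A ρ (suc d) S′ × count (touching A S) ≤ count (induced A S′)
      next : ∀ k {S′ E′} (F : Forest Q A (ρ ==_) S′ E′) → (∀ x → S x ≡ true → S′ x ≡ true) →
        (∀ x → S x ≡ true → depth F x ≤ d) → (∀ x → S′ x ≡ true → depth F x ≤ suc d) → n ≤ count S′ + k → Result
      add : ∀ k {S′ E′} (F : Forest Q A (ρ ==_) S′ E′) → (∀ x → S x ≡ true → S′ x ≡ true) →
        (∀ x → S x ≡ true → depth F x ≤ d) → (∀ x → S′ x ≡ true → depth F x ≤ suc d) → n ≤ count S′ + k →
        ∀ {p v e} → S p ≡ true → S′ v ≡ false → A e ≡ true → Joins Q e p v → Result
      next k {S′} F S⊆ deep deep′ h with bool (any (λ e → A e ∧ ((S (src Q e) ∧ not (S′ (tgt Q e))) ∨ (S (tgt Q e) ∧ not (S′ (src Q e))))))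
      ... | inj₁ some with any-elim _ some
      ...   | e , q with ∧-elim (A e) q
      ...     | a , z with ∨-elim (S (src Q e) ∧ not (S′ (tgt Q e))) z
      ...       | inj₁ w = add k F S⊆ deep deep′ h (proj₁ (∧-elim (S (src Q e)) w)) (not-elim (proj₂ (∧-elim (S (src Q e)) w))) a fwd
      ...       | inj₂ w = add k F S⊆ deep deep′ h (proj₁ (∧-elim (S (tgt Q e)) w)) (not-elim (proj₂ (∧-elim (S (tgt Q e)) w))) a bwd
      next k {S′} {E′} F S⊆ deep deep′ h | inj₂ none = S′ , record { edges = E′ ; forest = F ; shallow = deep′ } , count-mono swallowed
        where
        other : ∀ {e x y} → Joins Q e x y → A e ≡ true → S x ≡ true → S′ y ≡ true
        other {e} {x} {y} j a s with bool (S′ y) | j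
        ... | inj₁ t | _ = t
        ... | inj₂ t | fwd = tf-absurd (∧-intro a (∨-introˡ (∧-intro s (not-intro t)))) (any-false _ none e)
        ... | inj₂ t | bwd = tf-absurd (∧-intro a (∨-introʳ (S (src Q e) ∧ _) (∧-intro s (not-intro t)))) (any-false _ none e)
        swallowed : ∀ e → touching A S e ≡ true → induced A S′ e ≡ true
        swallowed e q with ∧-elim (A e) q
        ... | a , z with ∨-elim (S (src Q e)) z
        ...   | inj₁ s = ∧-intro a (∧-intro (S⊆ _ s) (other fwd a s))
        ...   | inj₂ s = ∧-intro a (∧-intro (other bwd a s) (S⊆ _ s))
      add zero {S′} F S⊆ deep deep′ h {v = v} sp sv a j =
        ⊥-elim (1+n≰n (≤-trans (≤-trans (≤-reflexive (sym (count-insert v S′ sv))) (count-≤ (insert v S′)))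
          (≤-trans h (≤-reflexive (+-identityʳ (count S′))))))
      add (suc k) {S′} F S⊆ deep deep′ h {p} {v} {e} sp sv a j = next k (leaf F p v e (S⊆ p sp) sv a j)
        (λ x s → insert-old v S′ (S⊆ x s))
        (λ x s → ≤-trans (≤-reflexive (depth-old F (S⊆ p sp) sv a j λ { refl → tf-absurd (S⊆ x s) sv })) (deep x s))
        (λ x s → case v ≟ x of λ
          { (yes q) → ≤-trans (≤-reflexive (depth-new F (S⊆ p sp) sv a j q)) (s≤s (deep p sp))
          ; (no ¬q) → ≤-trans (≤-reflexive (depth-old F (S⊆ p sp) sv a j ¬q)) (deep′ x (case insert-elim v S′ s of λ
              { (inj₁ t) → t ; (inj₂ t) → ⊥-elim (¬q t) })) })
        (≤-trans h (≤-reflexive (trans (+-suc (count S′) k) (cong (_+ k) (sym (count-insert v S′ sv))))))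

    -- While the boundary outweighs the inside, each expansion doubles the number of edges inside.
    grow-ball : ∀ L i f → i + f ≡ L → count A < 2 ^ L → ∀ {S} → Ball A ρ (suc i) S → 2 ^ i ≤ count (induced A S) →
      ∃ λ S′ → Ball A ρ L S′ × count (touching A S′) ≤ 2 * count (induced A S′)
    grow-ball L i zero refl small {S} 𝓑 big = ⊥-elim (<⇒≱ small
      (≤-trans (≤-reflexive (cong (2 ^_) (+-identityʳ i))) (≤-trans big (count-mono λ e p → proj₁ (∧-elim (A e) p)))))
    grow-ball L i (suc f) refl small {S} 𝓑 big with ≤-total (count (touching A S)) (2 * count (induced A S))
    ... | inj₁ h = S , record { Ball 𝓑 ; shallow = λ x s → ≤-trans (Ball.shallow 𝓑 x s) (≤-trans (s≤s (m≤m+n i f)) (≤-reflexive (sym (+-suc i f)))) } , h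
    ... | inj₂ h with expand 𝓑
    ...   | S′ , 𝓑′ , h′ = grow-ball L (suc i) f (sym (+-suc i f)) small 𝓑′ (≤-trans (*-monoʳ-≤ 2 big) (≤-trans h h′))

    ball : ∀ L → count A < 2 ^ L → (∃ λ e → A e ≡ true × src Q e ≡ ρ) →
      ∃ λ S → Ball A ρ L S × count (touching A S) ≤ 2 * count (induced A S)
    ball L small (e , a , refl) with expand {S = ρ ==_} (record { edges = λ _ → false ; forest = base ; shallow = λ _ _ → z≤n {0} })
    -- The first layer already contains `e`, so the doubling starts from one edge, 2^0, at depth 1;
    -- the depth stays one ahead of the exponent.
    ... | S , 𝓑 , h = grow-ball L 0 L refl small 𝓑 (≤-trans
            (≤-trans (≤-reflexive (sym (count-singleton e)))
              (count-mono λ f q → case ==⇒≡ e f q of λ { refl → ∧-intro a (∨-introˡ (≡⇒== {x = ρ} refl)) })) h)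

  ball-∋ : ∀ {A ρ d S} → Ball A ρ d S → S ρ ≡ true
  ball-∋ {ρ = ρ} 𝓑 = roots⊆ (Ball.forest 𝓑) ρ (≡⇒== {x = ρ} refl)

  ball⊆ : ∀ {A ρ d S} (V : Fin n → Bool) → (∀ e → A e ≡ true → inside Q V e ≡ true) → V ρ ≡ true →
    Ball A ρ d S → ∀ x → S x ≡ true → V x ≡ true
  ball⊆ {A} {ρ} V A⊆V ρ∈V 𝓑 = go (Ball.forest 𝓑)
    where
    go : ∀ {S E} → Forest Q A (ρ ==_) S E → ∀ x → S x ≡ true → V x ≡ true
    go base x q = subst (λ z → V z ≡ true) (==⇒≡ ρ x q) ρ∈V
    go (leaf {S} F p v e _ _ a j) x q with insert-elim v S q
    ... | inj₁ s    = go F x s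
    ... | inj₂ refl = proj₂ (joins-inside V j (A⊆V e a))

  -- A ball that is too sparse is deleted; this removes at most 2r edges per vertex.
  dense-ball : ∀ r L A V → (∀ e → A e ≡ true → inside Q V e ≡ true) → count A < 2 ^ L → 2 * (r * count V) < count A →
    ∃ λ A′ → (∀ e → A′ e ≡ true → A e ≡ true) × ∃ λ ρ → ∃ λ S → Ball A′ ρ L S × r * count S ≤ count (induced A′ S)
  dense-ball r L A V = go (count V) A V ≤-refl
    where
    go : ∀ k A V → count V ≤ k → (∀ e → A e ≡ true → inside Q V e ≡ true) → count A < 2 ^ L → 2 * (r * count V) < count A →
      ∃ λ A′ → (∀ e → A′ e ≡ true → A e ≡ true) × ∃ λ ρ → ∃ λ S → Ball A′ ρ L S × r * count S ≤ count (induced A′ S)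
    go k A V h A⊆V small many with count-pos A (≤-trans (s≤s z≤n) many)
    ... | e , a with ball {A} {src Q e} L small (e , a , refl)
    ...   | S , 𝓑 , thin with ≤-total (r * count S) (count (induced A S))
    ...     | inj₁ dense = A , (λ _ q → q) , src Q e , S , 𝓑 , dense
    ...     | inj₂ sparse = continue k h
      where
      A′ : Fin m → Bool
      A′ f = A f ∧ not (S (src Q f) ∨ S (tgt Q f))
      ρ∈V : V (src Q e) ≡ true
      ρ∈V = proj₁ (∧-elim (V (src Q e)) (A⊆V e a))
      S⊆V : ∀ x → S x ≡ true → V x ≡ true
      S⊆V = ball⊆ V A⊆V ρ∈V 𝓑
      V-count : count V ≡ count S + count (V ∖ S)
      V-count = trans (count-split V S) (cong (_+ count (V ∖ S)) (count-cong λ x → eq x))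
        where
        eq : ∀ x → V x ∧ S x ≡ S x
        eq x with bool (S x)
        ... | inj₁ q = trans (∧-intro (S⊆V x q) q) (sym q)
        ... | inj₂ q = trans (¬true⇒false λ z → tf-absurd (proj₂ (∧-elim (V x) z)) q) (sym q)
      A′⊆ : ∀ f → A′ f ≡ true → inside Q (V ∖ S) f ≡ true
      A′⊆ f q with ∧-elim (A f) q
      ... | af , ns with ∨-false (S (src Q f)) (not-elim ns) | ∧-elim (V (src Q f)) (A⊆V f af)
      ...   | s , t | u , w = ∧-intro (∖-intro V S u s) (∖-intro V S w t)
      many′ : 2 * (r * count (V ∖ S)) < count A′
      many′ = +-cancelˡ-< (2 * (r * count S)) _ _ (begin-strict
          2 * (r * count S) + 2 * (r * count (V ∖ S)) ≡⟨ sym (*-distribˡ-+ 2 (r * count S) _) ⟩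
          2 * (r * count S + r * count (V ∖ S))       ≡⟨ cong (2 *_) (sym (*-distribˡ-+ r (count S) _)) ⟩
          2 * (r * (count S + count (V ∖ S)))         ≡⟨ cong (λ z → 2 * (r * z)) (sym V-count) ⟩
          2 * (r * count V)                           <⟨ many ⟩
          count A                                     ≡⟨ count-split A (λ f → S (src Q f) ∨ S (tgt Q f)) ⟩
          count (touching A S) + count A′             ≤⟨ +-monoˡ-≤ (count A′) (≤-trans thin (*-monoʳ-≤ 2 sparse)) ⟩
          2 * (r * count S) + count A′                ∎)
        where open ≤-Reasoning
      smaller : count (V ∖ S) < count V
      smaller = ≤-trans (+-monoˡ-≤ (count (V ∖ S)) (≤-trans (≤-reflexive (sym (count-singleton (src Q e))))
          (count-mono λ x q → subst (λ z → S z ≡ true) (==⇒≡ _ x q) (ball-∋ 𝓑)))) (≤-reflexive (sym V-count))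
      continue : ∀ k → count V ≤ k → ∃ λ A′ → (∀ e → A′ e ≡ true → A e ≡ true) × ∃ λ ρ → ∃ λ S → Ball A′ ρ L S × r * count S ≤ count (induced A′ S)
      continue zero    h = ⊥-elim (n≮0 (<-≤-trans smaller h))
      continue (suc k) h with go k A′ (V ∖ S) (≤-pred (<-≤-trans smaller h)) A′⊆
                                (≤-<-trans (count-mono λ f q → proj₁ (∧-elim (A f) q)) small) many′
      ... | A″ , A″⊆ , rest = A″ , (λ f q → proj₁ (∧-elim (A f) (A″⊆ f q))) , rest

-- Small thetas from fundamental cuts of shallow trees

module _ {n m} {Q : Graph n m} {A : Fin m → Bool} {ρ : Fin n} {S₀ : Fin n → Bool} {L r : ℕ} where

  private
    I : Fin m → Bool
    I = induced Q A S₀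

    Small : Set
    Small = Σ (Fin m → Bool) λ M → (∀ e → M e ≡ true → A e ≡ true) × count M ≤ r + r * (L + L) × Theta Q M r

  module SmallCut {S E} (F : Forest Q A (ρ ==_) S E) {p v e} (p∈S : S p ≡ true) (v∉S : S v ≡ false) (e∈A : A e ≡ true)
           (j : Joins Q e p v) (𝓒 : Clustering Q A (insert v S)) where
    open Clustering 𝓒

    F⁺ : Forest Q A (ρ ==_) (insert v S) (insert e E)
    F⁺ = leaf F p v e p∈S v∉S e∈A j

    crossing : Fin m → Bool
    crossing τ = I τ ∧ not (eqb (v == loc (src Q τ)) (v == loc (tgt Q τ)))

    χ : Fin n → Bool
    χ u = v == loc u

    -- This is the fundamental cut of the tree edge `e`: one side is the cluster merged into `v`,
    -- the other belongs to the root `ρ`. The theta consists of r tokens and two routes of at most L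
    -- edges for each, whence r + r(L + L).
    small-cut : (∀ y → S₀ y ≡ true → count (path y) + depth F⁺ (loc y) ≤ L) →
      (∀ y → S₀ y ≡ true → insert v S (loc y) ≡ true) → r ≤ count crossing → Small
    small-cut short covered many with subset-of-size crossing r many
    ... | T , T⊆ , T-count = M , M⊆ , M-count , record
      { χ = χ ; a = v ; b = ρ ; tok = T ; tok⊆ = λ τ t → ∨-introˡ t ; enough = ≤-reflexive (sym T-count)
      ; cross = λ τ t → not-elim (proj₂ (∧-elim (I τ) (T⊆ τ t))) ; ends = ends }
      where
      record Route (y : Fin n) : Set where
        field
          route   : Fin m → Bool
          length  : count route ≤ L
          route⊆  : ∀ f → route f ≡ true → A f ≡ true × mono Q χ f ≡ true
          arrives : S₀ y ≡ true → Conn Q route y (if v == loc y then v else ρ)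
      v≢S : ∀ {u} → S u ≡ true → v ≢ u
      v≢S s refl = tf-absurd s v∉S
      path-mono : ∀ y f → path y f ≡ true → mono Q χ f ≡ true
      path-mono y f q with local y f q
      ... | s , t = ≡⇒eqb (cong (v ==_) (trans s (sym t)))
      -- Both ends of a remaining tree edge are unmerged and different from `v`, so the edge lies on
      -- the side of `ρ`.
      E-mono : ∀ f → E f ≡ true → mono Q χ f ≡ true
      E-mono f q with ∧-elim (S (src Q f)) (proj₂ (forest-edges F f q))
      ... | s , t = ≡⇒eqb (trans (off s) (sym (off t)))
        where
        off : ∀ {u} → S u ≡ true → (v == loc u) ≡ false
        off {u} s = ≢⇒== λ q → v≢S s (trans q (fixed u (insert-old v S s)))
      routes : ∀ y → Route y
      routes y with bool (S₀ y)
      -- The empty route is a dummy for vertices outside `S₀`; tokens have both ends in `S₀`.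
      ... | inj₂ q = record { route = λ _ → false ; length = ≤-trans (≤-reflexive (count-empty {m})) z≤n ; route⊆ = λ _ () ; arrives = λ s → tf-absurd s q }
      ... | inj₁ q with v ≟ loc y
      ...   | yes s = record { route = path y ; length = ≤-trans (m≤m+n _ _) (short y q)
                             ; route⊆ = λ f z → path⊆ y f z , path-mono y f z
                             ; arrives = λ _ → subst (Conn Q (path y) y) (trans (sym s) (sym (cong (if_then v else ρ) (≡⇒== s)))) (conn y) }
      ...   | no ¬s with root-path F (loc y) (case insert-elim v S (covered y q) of λ { (inj₁ t) → t ; (inj₂ t) → ⊥-elim (¬s t) })
      ...     | ρ′ , π , ρ∈ , len , π⊆ , c = record
        { route = λ f → path y f ∨ π f
        ; length = ≤-trans (count-∨ (path y) π) (≤-trans (+-monoʳ-≤ (count (path y)) (≤-trans len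
            (≤-reflexive (sym (depth-old F p∈S v∉S e∈A j ¬s))))) (short y q))
        ; route⊆ = λ f z → case ∨-elim (path y f) z of λ
            { (inj₁ w) → path⊆ y f w , path-mono y f w
            ; (inj₂ w) → proj₁ (forest-edges F f (π⊆ f w)) , E-mono f (π⊆ f w) }
        ; arrives = λ _ → conn-⊆ (λ f → ∨-introˡ) (conn y) ++
            subst (Conn Q _ (loc y)) (trans (sym (==⇒≡ ρ ρ′ ρ∈)) (sym (cong (if_then v else ρ) (≢⇒== ¬s)))) (conn-⊆ (λ f → ∨-introʳ (path y f)) c) }
      π₂ : Fin m → Fin m → Bool
      π₂ τ f = Route.route (routes (src Q τ)) f ∨ Route.route (routes (tgt Q τ)) f
      M : Fin m → Bool
      M f = T f ∨ any (λ τ → T τ ∧ π₂ τ f)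
      M⊆ : ∀ f → M f ≡ true → A f ≡ true
      M⊆ f q with ∨-elim (T f) q
      ... | inj₁ t = proj₁ (∧-elim (A f) (proj₁ (∧-elim (I f) (T⊆ f t))))
      ... | inj₂ s with any-elim _ s
      ...   | τ , u with ∨-elim (Route.route (routes (src Q τ)) f) (proj₂ (∧-elim (T τ) u))
      ...     | inj₁ w = proj₁ (Route.route⊆ (routes (src Q τ)) f w)
      ...     | inj₂ w = proj₁ (Route.route⊆ (routes (tgt Q τ)) f w)
      M-count : count M ≤ r + r * (L + L)
      M-count = ≤-trans (count-∨ T _) (≤-trans
        (+-monoʳ-≤ (count T) (count-∃ T π₂ (λ τ _ → ≤-trans (count-∨ (Route.route (routes (src Q τ))) (Route.route (routes (tgt Q τ))))
          (+-mono-≤ (Route.length (routes (src Q τ))) (Route.length (routes (tgt Q τ)))))))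
        (≤-reflexive (cong (λ z → z + z * (L + L)) T-count)))
      MM : Fin m → Bool
      MM f = M f ∧ mono Q χ f
      in-M : ∀ {τ f} → T τ ≡ true → π₂ τ f ≡ true → M f ≡ true
      in-M {τ} {f} t q = ∨-introʳ (T f) (any-intro (λ τ → T τ ∧ π₂ τ f) τ (∧-intro t q))
      to-src : ∀ {τ} → T τ ≡ true → Conn Q MM (src Q τ) (if v == loc (src Q τ) then v else ρ)
      to-src {τ} t = conn-⊆ (λ f q → ∧-intro (in-M t (∨-introˡ q)) (proj₂ (Route.route⊆ (routes (src Q τ)) f q)))
        (Route.arrives (routes (src Q τ)) (proj₁ (∧-elim (S₀ (src Q τ)) (proj₂ (∧-elim (A τ) (proj₁ (∧-elim (I τ) (T⊆ τ t))))))))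
      to-tgt : ∀ {τ} → T τ ≡ true → Conn Q MM (tgt Q τ) (if v == loc (tgt Q τ) then v else ρ)
      to-tgt {τ} t = conn-⊆ (λ f q → ∧-intro (in-M t (∨-introʳ (Route.route (routes (src Q τ)) f) q)) (proj₂ (Route.route⊆ (routes (tgt Q τ)) f q)))
        (Route.arrives (routes (tgt Q τ)) (proj₂ (∧-elim (S₀ (src Q τ)) (proj₂ (∧-elim (A τ) (proj₁ (∧-elim (I τ) (T⊆ τ t))))))))
      ends : ∀ τ → T τ ≡ true → ∃ λ x → ∃ λ y → Joins Q τ x y × Conn Q MM v x × Conn Q MM ρ y
      ends τ t with v == loc (src Q τ) | v == loc (tgt Q τ) | not-elim (proj₂ (∧-elim (I τ) (T⊆ τ t))) | to-src t | to-tgt t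
      ... | true  | false | _ | c | d = _ , _ , fwd , conn-sym c , conn-sym d
      ... | false | true  | _ | c | d = _ , _ , bwd , conn-sym d , conn-sym c

  private
    separated : ∀ {S} → Clustering Q A S → Fin m → Bool
    separated 𝓒 τ = I τ ∧ not (loc (src Q τ) == loc (tgt Q τ))
      where open Clustering 𝓒

  -- Leaves with fewer than r crossing edges are merged into their parents. Each merger makes at most r edges
  -- internal, so a tree on s vertices with at least rs edges must reach a leaf with r crossing edges.
  cut-tree : 1 ≤ r → ∀ {S E} (F : Forest Q A (ρ ==_) S E) (𝓒 : Clustering Q A S) → let open Clustering 𝓒 in
    (∀ y → S₀ y ≡ true → count (path y) + depth F (loc y) ≤ L) →
    (∀ y → S₀ y ≡ true → S (loc y) ≡ true) →
    r * count S ≤ count (separated 𝓒) → Small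
  -- Once only the root is left, everything is located there and no edge is separated, although at
  -- least r ≥ 1 separated edges should remain.
  cut-tree r≥1 base 𝓒 short covered many
    with count-pos (separated 𝓒) (≤-trans r≥1 (≤-trans (≤-reflexive (sym (trans (cong (r *_) (count-singleton ρ)) (*-identityʳ r)))) many))
  ... | τ , q with ∧-elim (I τ) q
  ...   | i , ne with ∧-elim (S₀ (src Q τ)) (proj₂ (∧-elim (A τ) i))
  ...     | s , t = tf-absurd (≡⇒== (trans (sym (==⇒≡ ρ _ (covered _ s))) (==⇒≡ ρ _ (covered _ t)))) (not-elim ne)
  cut-tree r≥1 (leaf {S} F p v e p∈S v∉S e∈A j) 𝓒 short covered many
    with ≤-total r (count (SmallCut.crossing F p∈S v∉S e∈A j 𝓒))
  ... | inj₁ h = SmallCut.small-cut F p∈S v∉S e∈A j 𝓒 short covered h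
  ... | inj₂ h = cut-tree r≥1 F absorb short′ covered′ many′
    where
    open Clustering 𝓒
    open Absorb p∈S v∉S e∈A j 𝓒
    crossing = SmallCut.crossing F p∈S v∉S e∈A j 𝓒
    covered′ : ∀ y → S₀ y ≡ true → S (redirect (loc y)) ≡ true
    covered′ y s with insert-elim v S (covered y s)
    ... | inj₁ t = trans (cong S (redirect-≢ (v≢S t))) t
    ... | inj₂ t = trans (cong S (redirect-≡ t)) p∈S
    -- Moving from `v` to its parent adds one edge to the path and removes one level of depth, so
    -- the sum does not grow.
    short′ : ∀ y → S₀ y ≡ true → count (path′ y) + depth F (redirect (loc y)) ≤ L
    short′ y s = case v ≟ loc y of λ
      { (yes q) → begin
          count (path′ y) + depth F (redirect (loc y)) ≡⟨ cong (λ z → count (path′ y) + depth F z) (redirect-≡ q) ⟩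
          count (path′ y) + depth F p
            ≤⟨ +-monoˡ-≤ (depth F p) (≤-trans (count-mono (one-more q)) (count-∨ (path y) (e ==_))) ⟩
          (count (path y) + count (e ==_)) + depth F p ≡⟨ cong (λ z → (count (path y) + z) + depth F p) (count-singleton e) ⟩
          (count (path y) + 1) + depth F p             ≡⟨ +-assoc (count (path y)) 1 _ ⟩
          count (path y) + suc (depth F p)             ≡⟨ cong (count (path y) +_) (sym (depth-new F p∈S v∉S e∈A j q)) ⟩
          _                                            ≤⟨ short y s ⟩
          L ∎
      ; (no ¬q) → begin
          count (path′ y) + depth F (redirect (loc y)) ≡⟨ cong (λ z → count (path′ y) + depth F z) (redirect-≢ ¬q) ⟩
          count (path′ y) + depth F (loc y)            ≤⟨ +-monoˡ-≤ _ (count-mono (no-more ¬q)) ⟩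
          count (path y) + depth F (loc y)             ≡⟨ cong (count (path y) +_) (sym (depth-old F p∈S v∉S e∈A j ¬q)) ⟩
          _                                            ≤⟨ short y s ⟩
          L ∎ }
      where
      open ≤-Reasoning
      one-more : v ≡ loc y → ∀ f → path′ y f ≡ true → path y f ∨ (e == f) ≡ true
      one-more q f w with path′-elim y f w
      ... | inj₁ a = ∨-introˡ a
      ... | inj₂ (_ , a) = ∨-introʳ (path y f) (≡⇒== a)
      no-more : v ≢ loc y → ∀ f → path′ y f ≡ true → path y f ≡ true
      no-more ¬q f w with path′-elim y f w
      ... | inj₁ a = a
      ... | inj₂ (q , _) = ⊥-elim (¬q q)
    lost : ∀ τ → separated 𝓒 τ ≡ true → crossing τ ∨ separated absorb τ ≡ true
    lost τ q with ∧-elim (I τ) q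
    ... | i , ne with bool (crossing τ)
    ...   | inj₁ c = ∨-introˡ c
    ...   | inj₂ c = ∨-introʳ (crossing τ) (∧-intro i (not-intro (≢⇒== still)))
      where
      same : (v == loc (src Q τ)) ≡ (v == loc (tgt Q τ))
      same with bool (eqb (v == loc (src Q τ)) (v == loc (tgt Q τ)))
      ... | inj₁ z = eqb⇒≡ z
      ... | inj₂ z = tf-absurd (∧-intro i (not-intro z)) c
      different : loc (src Q τ) ≢ loc (tgt Q τ)
      different z = tf-absurd (≡⇒== z) (not-elim ne)
      still : redirect (loc (src Q τ)) ≢ redirect (loc (tgt Q τ))
      still z = case v ≟ loc (src Q τ) of λ
        { (yes s) → different (trans (sym s) (==⇒≡ v _ (trans (sym same) (≡⇒== s))))
        ; (no ¬s) → different (trans (sym (redirect-≢ ¬s)) (trans z (redirect-≢ λ s →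
            ¬s (==⇒≡ v _ (trans same (≡⇒== s)))))) }
    many′ : r * count S ≤ count (separated absorb)
    many′ = +-cancelˡ-≤ r _ _ (begin
      r + r * count S               ≡⟨ sym (*-suc r (count S)) ⟩
      r * suc (count S)             ≡⟨ cong (r *_) (sym (count-insert v S v∉S)) ⟩
      r * count (insert v S)        ≤⟨ many ⟩
      count (separated 𝓒)               ≤⟨ count-mono lost ⟩
      count (λ τ → crossing τ ∨ separated absorb τ) ≤⟨ count-∨ crossing (separated absorb) ⟩
      count crossing + count (separated absorb) ≤⟨ +-monoˡ-≤ _ h ⟩
      r + count (separated absorb)      ∎)
      where open ≤-Reasoning

-- For the trivial clustering, looplessness makes every induced edge separated; the density of the
-- ball is then exactly what `cut-tree` starts from.
small-theta : ∀ {n m} (Q : Graph n m) r L A V → 1 ≤ r → (∀ e → A e ≡ true → src Q e ≢ tgt Q e) →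
  (∀ e → A e ≡ true → inside Q V e ≡ true) → count A < 2 ^ L → 2 * (r * count V) < count A →
  Σ (Fin m → Bool) λ M → (∀ e → M e ≡ true → A e ≡ true) × count M ≤ r + r * (L + L) × Theta Q M r
small-theta {n} {m} Q r L A V r≥1 loopless A⊆V few many with dense-ball Q r L A V A⊆V few many
... | A′ , A′⊆ , ρ , S , 𝓑 , dense
  with cut-tree {ρ = ρ} {S₀ = S} {L} {r} r≥1 (Ball.forest 𝓑) trivial
         (λ y s → ≤-trans (≤-reflexive (cong (_+ depth (Ball.forest 𝓑) y) (count-empty {m}))) (Ball.shallow 𝓑 y s)) (λ y s → s)
         (≤-trans dense (count-mono λ τ q → ∧-intro q (not-intro (≢⇒== (loopless τ (A′⊆ τ (proj₁ (∧-elim (A′ τ) q))))))))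
...   | M , M⊆ , M-count , θ = M , (λ e q → A′⊆ e (M⊆ e q)) , M-count , θ

-- Packing large bonds

module _ {n m} {G : Graph n m} {P : Fin m → Bool} {S : Fin n → Bool} (𝓒 : Clustering G P S) where
  open Clustering 𝓒

  -- Vertex and edge types are kept, so edge sets of the quotient are edge sets of `G` without
  -- translation. Vertices that are not locations become isolated, and density is measured against a
  -- set `V` instead of `n`.
  quotient : Graph n m
  quotient τ = loc (src G τ) , loc (tgt G τ)

  spokes : Fin m → Fin m → Bool
  spokes τ e = path (src G τ) e ∨ path (tgt G τ) e

  lift : (Fin m → Bool) → Fin m → Bool
  lift M e = M e ∨ any (λ τ → M τ ∧ spokes τ e)

  lift-spoke : ∀ M {τ e} → M τ ≡ true → spokes τ e ≡ true → lift M e ≡ true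
  lift-spoke M {τ} {e} p q = ∨-introʳ (M e) (any-intro (λ τ → M τ ∧ spokes τ e) τ (∧-intro p q))

  lift-elim : ∀ M e → lift M e ≡ true → M e ≡ true ⊎ ∃ λ τ → M τ ≡ true × ∃ λ y → (y ≡ src G τ ⊎ y ≡ tgt G τ) × path y e ≡ true
  lift-elim M e q with ∨-elim (M e) q
  ... | inj₁ p = inj₁ p
  ... | inj₂ p with any-elim _ p
  ...   | τ , s with ∧-elim (M τ) s
  ...     | t , u with ∨-elim (path (src G τ) e) u
  ...       | inj₁ w = inj₂ (τ , t , _ , inj₁ refl , w)
  ...       | inj₂ w = inj₂ (τ , t , _ , inj₂ refl , w)

  lift-⊆ : ∀ {M M′} → (∀ e → M e ≡ true → M′ e ≡ true) → ∀ e → lift M e ≡ true → lift M′ e ≡ true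
  lift-⊆ {M} {M′} h e q with lift-elim M e q
  ... | inj₁ p = ∨-introˡ (h e p)
  ... | inj₂ (τ , t , _ , inj₁ refl , w) = lift-spoke M′ (h τ t) (∨-introˡ w)
  ... | inj₂ (τ , t , _ , inj₂ refl , w) = lift-spoke M′ (h τ t) (∨-introʳ (path (src G τ) e) w)

  -- Colours are pulled back along `loc`. A path stays in one cluster, so it is monochromatic and
  -- can connect the ends of the quotient's edges inside `G`.
  lift-theta : ∀ {M r} → Theta quotient M r → Theta G (lift M) r
  lift-theta {M} θ = record
    { χ = χ ∘ loc ; a = a ; b = b ; tok = tok ; tok⊆ = λ e t → ∨-introˡ (tok⊆ e t) ; enough = enough ; cross = cross
    ; ends = λ e t → case ends e t of λ
        { (_ , _ , fwd , c , d) → _ , _ , fwd , unfold c ++ conn-sym (src-spoke (tok⊆ e t)) , unfold d ++ conn-sym (tgt-spoke (tok⊆ e t))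
        ; (_ , _ , bwd , c , d) → _ , _ , bwd , unfold c ++ conn-sym (tgt-spoke (tok⊆ e t)) , unfold d ++ conn-sym (src-spoke (tok⊆ e t)) } }
    where
    open Theta θ
    N : Fin m → Bool
    N f = lift M f ∧ mono G (χ ∘ loc) f
    path-mono : ∀ y f → path y f ≡ true → mono G (χ ∘ loc) f ≡ true
    path-mono y f q with local y f q
    ... | s , t = ≡⇒eqb (cong χ (trans s (sym t)))
    src-spoke : ∀ {τ} → M τ ≡ true → Conn G N (src G τ) (loc (src G τ))
    src-spoke {τ} t = conn-⊆ (λ f q → ∧-intro (lift-spoke M t (∨-introˡ q)) (path-mono _ f q)) (conn (src G τ))
    tgt-spoke : ∀ {τ} → M τ ≡ true → Conn G N (tgt G τ) (loc (tgt G τ))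
    tgt-spoke {τ} t = conn-⊆ (λ f q → ∧-intro (lift-spoke M t (∨-introʳ (path (src G τ) f) q)) (path-mono _ f q)) (conn (tgt G τ))
    unfold-edge : ∀ {τ x y} → M τ ∧ mono quotient χ τ ≡ true → Joins quotient τ x y → Conn G N x y
    unfold-edge {τ} q j with ∧-elim (M τ) q
    unfold-edge {τ} q fwd | t , s = conn-sym (src-spoke t) ++ edge τ (∧-intro (∨-introˡ t) s) fwd (tgt-spoke t)
    unfold-edge {τ} q bwd | t , s = conn-sym (tgt-spoke t) ++ edge τ (∧-intro (∨-introˡ t) s) bwd (src-spoke t)
    unfold : ∀ {x y} → Conn quotient (λ f → M f ∧ mono quotient χ f) x y → Conn G N x y
    unfold = conn-map id unfold-edge

  -- Each round finds a small theta in the quotient and discards all edges whose paths share an edge with its paths,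
  -- which keeps the lifted thetas edge-disjoint; the thetas may still share hub vertices.
  greedy-packing : ∀ {T c} r L V → 1 ≤ r → (∀ y → count (clash T 𝓒 y) ≤ c) →
    (∀ e → T e ≡ true → src quotient e ≢ tgt quotient e) → (∀ e → T e ≡ true → inside quotient V e ≡ true) →
    (∀ y e → path y e ≡ true → T e ≡ true → ⊥) →
    ∀ k A → (∀ e → A e ≡ true → T e ≡ true) → count A < 2 ^ L →
    2 * (r * count V) + k * ((r + r * (L + L)) * (1 + (c + c))) < count A → Packing G (lift A) r k
  greedy-packing r L V r≥1 light loopless T⊆V apart zero A A⊆T few many = empty-packing
  greedy-packing {T} {c} r L V r≥1 light loopless T⊆V apart (suc k) A A⊆T few many =
    round (small-theta quotient r L A V r≥1 (λ e p → loopless e (A⊆T e p)) (λ e p → T⊆V e (A⊆T e p)) few (≤-<-trans (m≤m+n _ _) many))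
    where
    round : (Σ (Fin m → Bool) λ M → (∀ e → M e ≡ true → A e ≡ true) × count M ≤ r + r * (L + L) × Theta quotient M r) → Packing G (lift A) r (suc k)
    round (M , M⊆ , M-count , θ) = packing-∷ (lift-⊆ M⊆) (lift-⊆ A′⊆) disjoint (lift-theta θ)
          (greedy-packing {T} {c} r L V r≥1 light loopless T⊆V apart k A′ (λ e p → A⊆T e (A′⊆ e p))
            (≤-<-trans (count-mono A′⊆) few) many′)
      where
      cl : Fin m → Fin m → Bool
      cl τ σ = clash T 𝓒 (src G τ) σ ∨ clash T 𝓒 (tgt G τ) σ
      killed A′ : Fin m → Bool
      killed σ = M σ ∨ any (λ τ → M τ ∧ cl τ σ)
      A′ σ = A σ ∧ not (killed σ)
      A′⊆ : ∀ e → A′ e ≡ true → A e ≡ true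
      A′⊆ e p = proj₁ (∧-elim (A e) p)
      s = r + r * (L + L)
      -- Each edge of the small theta costs itself and at most `c` clashes at each of its two ends.
      killed-count : count killed ≤ s * (1 + (c + c))
      killed-count = begin
        count killed                    ≤⟨ count-∨ M (λ σ → any (λ τ → M τ ∧ cl τ σ)) ⟩
        count M + count (λ σ → any (λ τ → M τ ∧ cl τ σ))
          ≤⟨ +-monoʳ-≤ (count M) (count-∃ M cl λ τ _ → ≤-trans (count-∨ (clash T 𝓒 (src G τ)) (clash T 𝓒 (tgt G τ)))
               (+-mono-≤ (light (src G τ)) (light (tgt G τ)))) ⟩
        count M + count M * (c + c)     ≡⟨ sym (*-suc (count M) (c + c)) ⟩
        count M * (1 + (c + c))         ≤⟨ *-monoˡ-≤ (1 + (c + c)) M-count ⟩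
        s * (1 + (c + c))               ∎
        where open ≤-Reasoning
      many′ : 2 * (r * count V) + k * (s * (1 + (c + c))) < count A′
      many′ = +-cancelˡ-< (s * (1 + (c + c))) _ _ (begin-strict
        s * (1 + (c + c)) + (2 * (r * count V) + k * (s * (1 + (c + c)))) ≡⟨ x∙yz≈y∙xz (s * (1 + (c + c))) (2 * (r * count V)) _ ⟩
        2 * (r * count V) + suc k * (s * (1 + (c + c)))                   <⟨ many ⟩
        count A                                                           ≡⟨ count-split A killed ⟩
        count (λ e → A e ∧ killed e) + count A′
          ≤⟨ +-monoˡ-≤ (count A′) (≤-trans (count-mono λ e p → proj₂ (∧-elim (A e) p)) killed-count) ⟩
        s * (1 + (c + c)) + count A′                                      ∎)
        where open ≤-Reasoning
      not-killed : ∀ {σ} → A′ σ ≡ true → M σ ≡ true ⊎ (∃ λ τ → M τ ≡ true × cl τ σ ≡ true) → ⊥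
      not-killed {σ} p (inj₁ q) = tf-absurd (∨-introˡ q) (not-elim (proj₂ (∧-elim (A σ) p)))
      not-killed {σ} p (inj₂ (τ , q , u)) = tf-absurd (∨-introʳ (M σ) (any-intro (λ τ → M τ ∧ cl τ σ) τ (∧-intro q u))) (not-elim (proj₂ (∧-elim (A σ) p)))
      clash-intro : ∀ {y σ z e} → A′ σ ≡ true → (z ≡ src G σ ⊎ z ≡ tgt G σ) → path y e ≡ true → path z e ≡ true → clash T 𝓒 y σ ≡ true
      clash-intro {y} {σ} {e = e} p (inj₁ refl) u w = ∧-intro (A⊆T σ (A′⊆ σ p)) (∨-introˡ (meets-intro 𝓒 y (src G σ) e u w))
      clash-intro {y} {σ} {e = e} p (inj₂ refl) u w = ∧-intro (A⊆T σ (A′⊆ σ p)) (∨-introʳ (meets 𝓒 y (src G σ)) (meets-intro 𝓒 y (tgt G σ) e u w))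
      -- A common edge is an edge of `T` in both lifts, an edge of `T` lying on a path, or an edge
      -- on two paths. These are excluded by deleting `M`, by `apart`, and by deleting the clashes.
      disjoint : ∀ e → lift M e ≡ true → lift A′ e ≡ true → ⊥
      disjoint e p q with lift-elim M e p | lift-elim A′ e q
      ... | inj₁ t | inj₁ t′ = not-killed t′ (inj₁ t)
      ... | inj₁ t | inj₂ (_ , _ , y , _ , w) = apart y e w (A⊆T e (M⊆ e t))
      ... | inj₂ (_ , _ , y , _ , w) | inj₁ t = apart y e w (A⊆T e (A′⊆ e t))
      ... | inj₂ (τ , t , _ , inj₁ refl , w) | inj₂ (σ , t′ , z , at , w′) = not-killed t′ (inj₂ (τ , t , ∨-introˡ (clash-intro t′ at w w′)))
      ... | inj₂ (τ , t , _ , inj₂ refl , w) | inj₂ (σ , t′ , z , at , w′) =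
              not-killed t′ (inj₂ (τ , t , ∨-introʳ (clash T 𝓒 (src G τ) σ) (clash-intro t′ at w w′)))

-- With h hubs, 8rh ≤ 2b. The quotient's edges from `T` live on the hubs and two roots, so 2r per
-- vertex amounts to at most 4r + b/2. The premise says that the other half of b exceeds 4r plus the
-- loss over k rounds.
bond-packing : ∀ {n m} {G : Graph n m} r k L b → 1 ≤ r → b < 2 ^ L →
  2 * (4 * r + k * ((r + r * (L + L)) * (1 + (8 * r + 8 * r)))) < b →
  ∀ P → Theta G P b → Packing G P r k
bond-packing {n} {m} {G} r k L b r≥1 b<2^L large P θ
  -- Exactly b tokens are kept because their number is also needed as an upper bound, below 2^L.
  with subset-of-size (Theta.tok θ) b (Theta.enough θ)
     | grow {G = G} {λ e → P e ∧ mono G (Theta.χ θ) e} {λ x → (Theta.a θ == x) ∨ (Theta.b θ == x)} base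
... | T , T⊆ , T-count | S , E , F , closed = packing-⊆ lift⊆P
    (greedy-packing clustering {T} {8 * r} r L V r≥1 light loopless T⊆V apart k T (λ _ q → q)
      (≤-<-trans (≤-reflexive T-count) b<2^L) (<-≤-trans many (≤-reflexive (sym T-count))))
  where
  open Theta θ renaming (b to b₀)
  P′ : Fin m → Bool
  P′ e = P e ∧ mono G χ e
  R : Fin n → Bool
  R x = (a == x) ∨ (b₀ == x)
  hubs : Hubs G P′ T (8 * r) S R
  hubs = peel G P′ T (8 * r) S F (no-hubs G P′ T (8 * r) S)
  open Hubs hubs
  V : Fin n → Bool
  V x = R x ∨ hub x
  T-ends : ∀ e → T e ≡ true → S (src G e) ≡ true × S (tgt G e) ≡ true
  T-ends e t with ends e (T⊆ e t)
  ... | x , y , j , c , d = joins⇒ends (λ z → S z ≡ true) j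
          (conn-ind (λ z → S z ≡ true) closed c (roots⊆ F a (∨-introˡ (≡⇒== {x = a} refl))))
          (conn-ind (λ z → S z ≡ true) closed d (roots⊆ F b₀ (∨-introʳ (a == b₀) (≡⇒== {x = b₀} refl))))
  T⊆V : ∀ e → T e ≡ true → inside (quotient clustering) V e ≡ true
  T⊆V e t = ∧-intro (in-V (covered _ (proj₁ (T-ends e t)))) (in-V (covered _ (proj₂ (T-ends e t))))
    where
    in-V : ∀ {x} → R x ≡ true ⊎ hub x ≡ true → V x ≡ true
    in-V (inj₁ q) = ∨-introˡ q
    in-V {x} (inj₂ q) = ∨-introʳ (R x) q
  -- Merging follows monochromatic tree edges and so never changes sides. Hence no bond edge turns
  -- into a loop of the quotient.
  loc-side : ∀ y → χ y ≡ χ (loc y)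
  loc-side y = conn-mono {χ = χ} (λ e q → proj₂ (∧-elim (P e) (path⊆ y e q))) (conn y)
  apart : ∀ y e → path y e ≡ true → T e ≡ true → ⊥
  apart y e q t = tf-absurd (proj₂ (∧-elim (P e) (path⊆ y e q))) (cross e (T⊆ e t))
  loopless : ∀ e → T e ≡ true → loc (src G e) ≢ loc (tgt G e)
  loopless e t q = tf-absurd (≡⇒eqb (trans (loc-side (src G e)) (trans (cong χ q) (sym (loc-side (tgt G e)))))) (cross e (T⊆ e t))
  lift⊆P : ∀ e → lift clustering T e ≡ true → P e ≡ true
  lift⊆P e q with lift-elim clustering T e q
  ... | inj₁ t = tok⊆ e (T⊆ e t)
  ... | inj₂ (_ , _ , y , _ , w) = proj₁ (∧-elim (P e) (path⊆ y e w))
  V-count : count V ≤ 2 + count hub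
  V-count = ≤-trans (count-∨ R hub) (+-monoˡ-≤ (count hub) (≤-trans (count-∨ (a ==_) (b₀ ==_))
    (≤-reflexive (cong₂ _+_ (count-singleton a) (count-singleton b₀)))))
  few-hubs : 8 * r * count hub ≤ b + b
  few-hubs = ≤-trans heavy (+-mono-≤ (bound (src G)) (bound (tgt G)))
    where
    bound : ∀ end → count (λ τ → T τ ∧ hub (loc (end τ))) ≤ b
    bound end = ≤-trans (count-mono λ τ q → proj₁ (∧-elim (T τ) q)) (≤-reflexive T-count)
  K = k * ((r + r * (L + L)) * (1 + (8 * r + 8 * r)))
  many : 2 * (r * count V) + K < b
  many = *-cancelˡ-< 4 _ _ (begin-strict
    4 * (2 * (r * count V) + K)               ≤⟨ *-monoʳ-≤ 4 (+-monoˡ-≤ K (*-monoʳ-≤ 2 (*-monoʳ-≤ r V-count))) ⟩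
    4 * (2 * (r * (2 + count hub)) + K)       ≡⟨ expand-count r (count hub) K ⟩
    8 * r * count hub + 2 * (2 * (4 * r + K)) <⟨ +-mono-≤-< few-hubs (*-monoʳ-< 2 large) ⟩
    (b + b) + 2 * b                           ≡⟨ double b ⟩
    4 * b                                     ∎)
    where
    open ≤-Reasoning
    expand-count : ∀ r h K → 4 * (2 * (r * (2 + h)) + K) ≡ 8 * r * h + 2 * (2 * (4 * r + K))
    expand-count = solve-∀
    double : ∀ b → (b + b) + 2 * b ≡ 4 * b
    double = solve-∀

-- The bounds

packing⇒models : ∀ {n m} {G : Graph n m} {P r k} → 1 ≤ r → Packing G P r k → DisjointModels G r k
packing⇒models {G = G} {r = r} {k} r≥1 𝓜 = (λ i → proj₁ (model i)) ,
  λ { i j i≢j _ ((e , refl) , (e′ , q)) →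
      disjoint i j i≢j _ (proj₂ (model i) e) (subst (λ z → part j z ≡ true) q (proj₂ (model j) e′)) }
  where
  open Packing 𝓜
  model : ∀ i → Σ (Model G r) λ M → ∀ e → part i (Model.eemb M e) ≡ true
  model i = theta⇒model r≥1 (theta i)

∣tabulate∣ : ∀ {n} (f : Fin n → Bool) → ∣ tabulate f ∣ ≡ count f
∣tabulate∣ {zero}  f = refl
∣tabulate∣ {suc n} f with f zero
... | true  = cong suc (∣tabulate∣ (f ∘ suc))
... | false = ∣tabulate∣ (f ∘ suc)

cover⇒hits : ∀ {n m} {G : Graph n m} {r} (X : Fin m → Bool) → ¬ Theta G (λ e → not (X e)) r → Hits G r (tabulate X)
cover⇒hits {G = G} {r} X ¬θ M with bool (any (X ∘ Model.eemb M))
... | inj₁ p with any-elim _ p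
...   | e , q = _ , (e , refl) , lookup⇒[]= _ (tabulate X) (trans (lookup∘tabulate X _) q)
cover⇒hits {G = G} {r} X ¬θ M | inj₂ p =
  ⊥-elim (¬θ (model⇒theta M _ λ e → not-intro (any-false (X ∘ Model.eemb M) p e)))

n<2^[1+log₂n] : ∀ n → n < 2 ^ suc ⌊log₂ n ⌋
n<2^[1+log₂n] n = ≰⇒> λ h → 1+n≰n (≤-trans (≤-reflexive (sym (⌊log₂[2^n]⌋≡n (suc ⌊log₂ n ⌋)))) (⌊log₂⌋-mono-≤ h))

n<2^n : ∀ n → n < 2 ^ n
n<2^n zero    = s≤s z≤n
n<2^n (suc n) = begin-strict
  suc n         <⟨ s≤s (n<2^n n) ⟩
  1 + 2 ^ n     ≤⟨ +-mono-≤ (m^n>0 2 n) (≤-reflexive (sym (+-identityʳ (2 ^ n)))) ⟩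
  2 ^ suc n     ∎
  where open ≤-Reasoning

m≤m*n-pos : ∀ m {n} → 1 ≤ n → m ≤ m * n
m≤m*n-pos m {n} h = ≤-trans (≤-reflexive (sym (*-identityʳ m))) (*-monoʳ-≤ m h)

scale-≤ : ∀ C x y {z} → z ≤ C * x → x ≤ y → z ≤ C * y
scale-≤ C x y p q = ≤-trans p (*-monoʳ-≤ C q)

-- The premise of bond-packing with c = 8r, where L bounds the depth of the balls.
bond-size : ℕ → ℕ → ℕ → ℕ
bond-size k r L = suc (2 * (4 * r + k * ((r + r * (L + L)) * (1 + (8 * r + 8 * r)))))

-- Every lower-order term is raised to a multiple of k r² L, using k, r, L ≥ 1. The coefficients add
-- up to 1 + 2·4 + 2·3·17 = 111.
bond-size-≤ : ∀ k r L → 1 ≤ k → 1 ≤ r → 1 ≤ L → bond-size k r L ≤ 111 * (k * (r * r) * L)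
bond-size-≤ k r L k≥1 r≥1 L≥1 = ≤-trans
  (+-mono-≤ X≥1 (*-monoʳ-≤ 2 (+-mono-≤ (*-monoʳ-≤ 4 r≤X)
    (*-monoʳ-≤ k (*-mono-≤ (+-monoˡ-≤ (r * (L + L)) (m≤m*n-pos r L≥1)) (+-monoˡ-≤ (8 * r + 8 * r) r≥1))))))
  (≤-reflexive (collect k r L))
  where
  r≤X : r ≤ k * (r * r) * L
  r≤X = ≤-trans (m≤m*n-pos r r≥1) (≤-trans (≤-trans (≤-reflexive (sym (*-identityˡ (r * r)))) (*-monoˡ-≤ (r * r) k≥1)) (m≤m*n-pos (k * (r * r)) L≥1))
  X≥1 : 1 ≤ k * (r * r) * L
  X≥1 = ≤-trans r≥1 r≤X
  collect : ∀ k r L → k * (r * r) * L + 2 * (4 * (k * (r * r) * L) + k * ((r * L + r * (L + L)) * (r + (8 * r + 8 * r)))) ≡ 111 * (k * (r * r) * L)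
  collect = solve-∀

private
  -- The factor 111 is rounded up to 128 so that 128·16 = 2048 is a power of two; the rest is
  -- bounded by (kr)² ℓ ≤ x³.
  cube-≤ : ∀ k r ℓ x → 1 ≤ k → k * r ≤ x → ℓ ≤ x → 111 * (k * (r * r) * (16 * ℓ)) ≤ 2048 * (x * (x * x))
  cube-≤ k r ℓ x k≥1 kr≤x ℓ≤x = ≤-trans (*-mono-≤ {111} {128} (m≤m+n 111 17)
      (*-monoˡ-≤ (16 * ℓ) (≤-trans (m≤m*n-pos (k * (r * r)) k≥1) (≤-reflexive (square k r)))))
    (scale-≤ 128 (k * r * (k * r) * (16 * ℓ)) (x * x * (16 * x)) ≤-refl (*-mono-≤ (*-mono-≤ kr≤x kr≤x) (*-monoʳ-≤ 16 ℓ≤x))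
      ∙ powers x)
    where
    _∙_ : ∀ {a b c} → a ≤ b → b ≡ c → a ≤ c
    p ∙ refl = p
    square : ∀ k r → k * (r * r) * k ≡ k * r * (k * r)
    square = solve-∀
    powers : ∀ x → 128 * (x * x * (16 * x)) ≡ 2048 * (x * (x * x))
    powers = solve-∀

  2^-cube : ∀ ℓ → 2 ^ (11 + (ℓ + (ℓ + ℓ))) ≡ 2 ^ 11 * (2 ^ ℓ * (2 ^ ℓ * 2 ^ ℓ))
  2^-cube ℓ = trans (^-distribˡ-+-* 2 11 (ℓ + (ℓ + ℓ))) (cong (2 ^ 11 *_)
    (trans (^-distribˡ-+-* 2 ℓ (ℓ + ℓ)) (cong (2 ^ ℓ *_) (^-distribˡ-+-* 2 ℓ ℓ))))

  exponent-< : ∀ ℓ → 1 ≤ ℓ → 11 + (ℓ + (ℓ + ℓ)) < 16 * ℓ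
  exponent-< ℓ ℓ≥1 = begin-strict
    11 + (ℓ + (ℓ + ℓ))     <⟨ +-monoˡ-< (ℓ + (ℓ + ℓ)) (m<m+n 11 {2} (s≤s z≤n)) ⟩
    13 + (ℓ + (ℓ + ℓ))     ≤⟨ +-monoˡ-≤ (ℓ + (ℓ + ℓ)) (m≤m*n-pos 13 ℓ≥1) ⟩
    13 * ℓ + (ℓ + (ℓ + ℓ)) ≡⟨ sixteen ℓ ⟩
    16 * ℓ ∎
    where
    open ≤-Reasoning
    sixteen : ∀ x → 13 * x + (x + (x + x)) ≡ 16 * x
    sixteen = solve-∀

-- This closes the circle between the bond size, which depends on the radius, and the radius, which
-- must exceed the logarithm of the bond size: at radius 16ℓ the size is at most 2^(11 + 3ℓ), and 11
-- + 3ℓ < 16ℓ.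
bond-size-<2^ : ∀ k r ℓ → 1 ≤ k → 1 ≤ r → 1 ≤ ℓ → k * r ≤ 2 ^ ℓ → bond-size k r (16 * ℓ) < 2 ^ (16 * ℓ)
bond-size-<2^ k r ℓ k≥1 r≥1 ℓ≥1 kr≤ =
  ≤-<-trans (≤-trans (bond-size-≤ k r (16 * ℓ) k≥1 r≥1 (≤-trans ℓ≥1 (m≤m+n ℓ (15 * ℓ))))
      (≤-trans (cube-≤ k r ℓ (2 ^ ℓ) k≥1 kr≤ (<⇒≤ (n<2^n ℓ)))
        (≤-reflexive (trans (cong (_* (2 ^ ℓ * (2 ^ ℓ * 2 ^ ℓ))) 2048≡2^11) (sym (2^-cube ℓ))))))
    (^-monoʳ-< 2 (s≤s (s≤s z≤n)) (exponent-< ℓ ℓ≥1))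
  where
  2048≡2^11 : 2048 ≡ 2 ^ 11
  2048≡2^11 = refl

-- One bond boundary for each of the k rounds. The successor of the rounded-down logarithm ensures
-- that kr is below the corresponding power of two.
bound : ℕ → ℕ → ℕ
bound k r = k * bond-size k r (16 * suc ⌊log₂ (k * r) ⌋)

-- Since kr ≥ 2, the logarithm l is at least 1, and 1 + l ≤ 2l absorbs the successor; 3552 =
-- 111·16·2.
bound-≤ : ∀ k r → 1 ≤ k → 2 ≤ r → bound k r ≤ 3552 * (k * k * (r * r) * ⌊log₂ (k * r) ⌋)
bound-≤ k r k≥1 r≥2 = general ⌊log₂ (k * r) ⌋
    (≤-trans (≤-reflexive (sym (⌊log₂[2^n]⌋≡n 1))) (⌊log₂⌋-mono-≤ (*-mono-≤ k≥1 r≥2)))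
  where
  collect : ∀ k r l → k * (111 * (k * (r * r) * (16 * (l + l)))) ≡ 3552 * (k * k * (r * r) * l)
  collect = solve-∀
  general : ∀ l → 1 ≤ l → k * bond-size k r (16 * suc l) ≤ 3552 * (k * k * (r * r) * l)
  general l l≥1 = ≤-trans (*-monoʳ-≤ k (scale-≤ 111 (k * (r * r) * (16 * suc l)) (k * (r * r) * (16 * (l + l)))
      (bond-size-≤ k r (16 * suc l) k≥1 (≤-trans (s≤s z≤n) r≥2) (s≤s z≤n))
      (*-monoʳ-≤ (k * (r * r)) (*-monoʳ-≤ 16 (+-monoˡ-≤ l l≥1)))))
    (≤-reflexive (collect k r l))

erdős–pósa : EPAlternative bound
erdős–pósa r r≥2 {n} {m} G loopless k k≥1 =
  conclude (pack-or-cover {G = G} r≥1 loopless {B} {k}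
    (bond-packing r k (16 * ℓ) B r≥1 (bond-size-<2^ k r ℓ k≥1 r≥1 (s≤s z≤n) (<⇒≤ (n<2^[1+log₂n] (k * r)))) ≤-refl)
    k ≤-refl (λ _ → true))
  where
  ℓ B : ℕ
  ℓ = suc ⌊log₂ (k * r) ⌋
  B = bond-size k r (16 * ℓ)
  r≥1 : 1 ≤ r
  r≥1 = ≤-trans (s≤s z≤n) r≥2
  conclude : Packing G (inside G (λ _ → true)) r k ⊎
      (Σ (Fin m → Bool) λ X → count X ≤ k * B × ¬ Theta G (λ e → not (X e)) r) →
    DisjointModels G r k ⊎ (Σ (Subset m) λ X → (∣ X ∣ ≤ bound k r) × Hits G r X)
  conclude (inj₁ 𝓜) = inj₁ (packing⇒models r≥1 𝓜)
  conclude (inj₂ (X , X-count , ¬θ)) = inj₂ (tabulate X , ≤-trans (≤-reflexive (∣tabulate∣ X)) X-count , cover⇒hits X ¬θ)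

theorem1 : Σ (ℕ → ℕ → ℕ) λ f → Σ (ℕ → ℕ → ℕ) λ g →
    (∃ λ C → ∃ λ c → (k r : ℕ) → 1 ≤ k → 2 ≤ r →
    f k r ≤ C * (k ^ 2 * r ^ 3 * ⌊log₂ (k * r) ⌋ ^ c)) ×
    (∃ λ C → ∃ λ c → (k r : ℕ) → 1 ≤ k → 2 ≤ r →
    g k r ≤ C * (k ^ 4 * r ^ 2 * ⌊log₂ (k * r) ⌋ ^ c)) ×
    EPAlternative f × EPAlternative g
theorem1 = bound , bound ,
  (3552 , 1 , λ k r k≥1 r≥2 → scale-≤ 3552 (k * k * (r * r) * ⌊log₂ (k * r) ⌋) (k ^ 2 * r ^ 3 * ⌊log₂ (k * r) ⌋ ^ 1) (bound-≤ k r k≥1 r≥2)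
    (*-mono-≤ (*-mono-≤ (≤-reflexive (sym (square k))) (≤-trans (≤-reflexive (sym (square r))) (^-monoʳ-≤ r {{>-nonZero (≤-trans (s≤s z≤n) r≥2)}} (n≤1+n 2))))
              (≤-reflexive (sym (^-identityʳ ⌊log₂ (k * r) ⌋))))) ,
  (3552 , 1 , λ k r k≥1 r≥2 → scale-≤ 3552 (k * k * (r * r) * ⌊log₂ (k * r) ⌋) (k ^ 4 * r ^ 2 * ⌊log₂ (k * r) ⌋ ^ 1) (bound-≤ k r k≥1 r≥2)
    (*-mono-≤ (*-mono-≤ (≤-trans (≤-reflexive (sym (square k))) (^-monoʳ-≤ k {{>-nonZero k≥1}} (m≤m+n 2 2))) (≤-reflexive (sym (square r))))
              (≤-reflexive (sym (^-identityʳ ⌊log₂ (k * r) ⌋))))) ,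
  erdős–pósa , erdős–pósa
  where
  square : ∀ x → x ^ 2 ≡ x * x
  square x = cong (x *_) (*-identityʳ x)
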